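{- Let $m\ge 1$ and let $D$ be a strong digraph of order $n=2m+1\geq 3$ which contains a (directed) cycle of length $n-1$. Then at least one of the following holds: (i) $D$ contains a cycle containing all vertices $v$ with $d^+(v)\ge m$ and $d^-(v)\ge m$; (ii) $D$ is isomorphic to $D_5$ or to $D_7$, or $D$ is isomorphic to a member of $L_1\cup L_2$; (iii) $D$ contains a spanning subdigraph isomorphic to $K^*_{m,m+1}$, and $D$ is isomorphic to a spanning subdigraph of $[K_m+\overline K_{m+1}]^*$; (iv) $D$ contains a cycle $C=x_1x_2\ldots x_{2m}x_1$ of length $n-1$ (indices taken modulo $2m$) with the following property: if $x$ is the vertex of $D$ not on $C$ and $x$ is not adjacent to the vertices $x_{l_1},x_{l_2},\ldots,x_{l_j}$ of $C$, where $j\ge 3$, then for every $i\in[1,j]$ we have $x_{l_i-1}x\in A(D)$, $xx_{l_i+1}\in A(D)$, $N^+(x)=N^+(x_{l_i})$ and $N^-(x)=N^-(x_{l_i})$; in particular, $\{x_{l_1},x_{l_2},\ldots,x_{l_j},x\}$ is an independent set of vertices.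
   Context: Digraphs are finite, without loops and without multiple arcs (opposite arcs $uv,vu$ allowed). $A(D)$ is the arc set; $N^+(v)$, $N^-(v)$ are the out- and in-neighbourhoods of $v$, and $d^\pm(v)=|N^\pm(v)|$. Two distinct vertices are adjacent if at least one arc joins them. $D$ is strong if for every ordered pair of distinct vertices there is a directed path from the first to the second. For $a\le b$ integers, $[a,b]=\{a,a+1,\ldots,b\}$. $D_7$: vertex set $\{x_1,x_2,x_3,x_4,x_5,x,y\}$ with $N^+(x_1)=\{x_2,x_5,y\}$, $N^+(x_2)=\{x_3,x_4,y\}$, $N^+(x_3)=\{x_2,x_4,x\}$, $N^+(x_4)=\{x_3,x_5,x\}$, $N^+(x_5)=\{x_1,x,y\}$, $N^+(x)=\{x_1,x_2,x_3\}$, $N^+(y)=\{x_1,x_4,x_5\}$. $D_5$: vertex set $\{x_1,x_2,x_3,x,y\}$ with $N^+(x_1)=\{x_2,y\}$, $N^+(x_2)=\{x_3,x\}$, $N^+(x_3)=\{x,y\}$, $N^+(x)=\{x_1,x_2\}$, $N^+(y)=\{x_1,x_3\}$. $L_1$ is the set of the three digraphs obtained from $D_5$ by adding the arc $x_1x_3$, or the arc $x_3x_1$, or both. $L_2$ is the set of digraphs $D$ with vertex set $\{x_1,\ldots,x_{2m},x\}$ such that: $D$ contains the cycle $x_1x_2\ldots x_{2m}x_1$ and $x$, $x_{2m}$ are not adjacent; $N^+(x)=N^+(x_{2m})=\{x_1,\ldots,x_m\}$ and $N^-(x)=N^-(x_{2m})=\{x_m,x_{m+1},\ldots,x_{2m-1}\}$;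 there is no arc from $\{x_1,\ldots,x_{m-1}\}$ to $\{x_{m+1},\ldots,x_{2m-1}\}$; the induced subdigraphs on $\{x_1,\ldots,x_m\}$ and on $\{x_m,\ldots,x_{2m-1}\}$ are arbitrary, and any number of arcs from $\{x_{m+1},\ldots,x_{2m-1}\}$ to $\{x_1,\ldots,x_m\}$ may be present. For an undirected graph $G$, $G^*$ is the symmetric digraph obtained by replacing each edge $uv$ by the two arcs $uv,vu$. $K_m$ is the complete graph on $m$ vertices, $\overline K_{m+1}$ the edgeless graph on $m+1$ vertices, $K_{m,m+1}$ the complete bipartite graph with parts of sizes $m$ and $m+1$, and $K_m+\overline K_{m+1}$ the join of $K_m$ and $\overline K_{m+1}$ (disjoint union plus all edges between the two). -}

module Defs where

open import Data.Nat using (ℕ; zero; suc; _+_; _*_; _∸_; _≤_; _<_)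
open import Data.Nat.DivMod using (_mod_)
open import Data.Fin using (Fin; toℕ; inject₁) renaming (zero to fzero; suc to fsuc)
open import Data.Bool using (Bool; true; false; if_then_else_; _∨_; not)
open import Data.List using (List; map; allFin)
open import Data.Nat.ListAction using (sum)
open import Data.Product using (Σ; ∃; _×_; _,_)
open import Data.Sum using (_⊎_)
open import Relation.Nullary using (¬_)
open import Relation.Binary.PropositionalEquality using (_≡_; _≢_; refl)
open import Function.Definitions using (Injective; Bijective)

record Digraph (n : ℕ) : Set where
  field
    arc      : Fin n → Fin n → Bool
    loopless : ∀ v → arc v v ≡ false
open Digraph public

Arc : ∀ {n} → Digraph n → Fin n → Fin n → Set
Arc D u v = arc D u v ≡ true

adjB : ∀ {n} → Digraph n → Fin n → Fin n → Bool
adjB D u v = arc D u v ∨ arc D v u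

Adjacent : ∀ {n} → Digraph n → Fin n → Fin n → Set
Adjacent D u v = adjB D u v ≡ true

countB : ∀ {A : Set} → (A → Bool) → List A → ℕ
countB p xs = sum (map (λ a → if p a then 1 else 0) xs)

outdeg : ∀ {n} → Digraph n → Fin n → ℕ
outdeg {n} D v = countB (λ w → arc D v w) (allFin n)

indeg : ∀ {n} → Digraph n → Fin n → ℕ
indeg {n} D v = countB (λ w → arc D w v) (allFin n)

cnext : ∀ {k} → Fin k → Fin k
cnext {suc k} i = suc (toℕ i) mod (suc k)

cprev : ∀ {k} → Fin k → Fin k
cprev {suc k} i = (toℕ i + k) mod (suc k)

record Path {n} (D : Digraph n) (u v : Fin n) : Set where
  field
    len    : ℕ
    vtx    : Fin (suc len) → Fin n
    inj    : Injective _≡_ _≡_ vtx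
    start  : vtx fzero ≡ u
    end    : vtx (Data.Fin.fromℕ len) ≡ v
    steps  : ∀ (i : Fin len) → Arc D (vtx (inject₁ i)) (vtx (fsuc i))

Strong : ∀ {n} → Digraph n → Set
Strong {n} D = ∀ (u v : Fin n) → u ≢ v → Path D u v

record Cycle {n} (D : Digraph n) (k : ℕ) : Set where
  field
    cyc    : Fin k → Fin n
    inj    : Injective _≡_ _≡_ cyc
    len≥2  : 2 ≤ k
    steps  : ∀ (i : Fin k) → Arc D (cyc i) (cyc (cnext i))
open Cycle public

OnCycle : ∀ {n k} {D : Digraph n} → Cycle D k → Fin n → Set
OnCycle C v = ∃ λ i → cyc C i ≡ v

Iso : ∀ {n n'} → Digraph n → Digraph n' → Set
Iso {n} {n'} D H = Σ (Fin n → Fin n') λ f →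
  Bijective _≡_ _≡_ f × (∀ u v → arc D u v ≡ arc H (f u) (f v))

IsoToSpanningSub : ∀ {n n'} → Digraph n → Digraph n' → Set
IsoToSpanningSub {n} {n'} D H = Σ (Fin n → Fin n') λ f →
  Bijective _≡_ _≡_ f × (∀ u v → Arc D u v → Arc H (f u) (f v))

ContainsSpanning : ∀ {n n'} → Digraph n → Digraph n' → Set
ContainsSpanning D H = IsoToSpanningSub H D

-- D₅ (optionally with extra arcs x₁x₃ (flag a) and x₃x₁ (flag b)).
-- Vertices: x₁ = 0, x₂ = 1, x₃ = 2, x = 3, y = 4.
D5arc : Bool → Bool → Fin 5 → Fin 5 → Bool
D5arc a b fzero (fsuc fzero) = true
D5arc a b fzero (fsuc (fsuc (fsuc (fsuc fzero)))) = true
D5arc a b fzero (fsuc (fsuc fzero)) = a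
D5arc a b (fsuc fzero) (fsuc (fsuc fzero)) = true
D5arc a b (fsuc fzero) (fsuc (fsuc (fsuc fzero))) = true
D5arc a b (fsuc (fsuc fzero)) (fsuc (fsuc (fsuc fzero))) = true
D5arc a b (fsuc (fsuc fzero)) (fsuc (fsuc (fsuc (fsuc fzero)))) = true
D5arc a b (fsuc (fsuc fzero)) fzero = b
D5arc a b (fsuc (fsuc (fsuc fzero))) fzero = true
D5arc a b (fsuc (fsuc (fsuc fzero))) (fsuc fzero) = true
D5arc a b (fsuc (fsuc (fsuc (fsuc fzero)))) fzero = true
D5arc a b (fsuc (fsuc (fsuc (fsuc fzero)))) (fsuc (fsuc fzero)) = true
D5arc a b _ _ = false

D5ext : Bool → Bool → Digraph 5
D5ext a b = record
  { arc = D5arc a b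
  ; loopless = λ { fzero → refl ; (fsuc fzero) → refl ; (fsuc (fsuc fzero)) → refl
                 ; (fsuc (fsuc (fsuc fzero))) → refl ; (fsuc (fsuc (fsuc (fsuc fzero)))) → refl } }

D5 : Digraph 5
D5 = D5ext false false

IsoToL1 : ∀ {n} → Digraph n → Set
IsoToL1 D = Σ Bool λ a → Σ Bool λ b → (a ∨ b) ≡ true × Iso D (D5ext a b)

-- D₇. Vertices: x₁ = 0, …, x₅ = 4, x = 5, y = 6.
D7arc : Fin 7 → Fin 7 → Bool
D7arc u v = go (toℕ u) (toℕ v)
  where
  go : ℕ → ℕ → Bool
  go 0 1 = true
  go 0 4 = true
  go 0 6 = true
  go 1 2 = true
  go 1 3 = true
  go 1 6 = true
  go 2 1 = true
  go 2 3 = true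
  go 2 5 = true
  go 3 2 = true
  go 3 4 = true
  go 3 5 = true
  go 4 0 = true
  go 4 5 = true
  go 4 6 = true
  go 5 0 = true
  go 5 1 = true
  go 5 2 = true
  go 6 0 = true
  go 6 3 = true
  go 6 4 = true
  go _ _ = false

D7 : Digraph 7
D7 = record
  { arc = D7arc
  ; loopless = λ { fzero → refl ; (fsuc fzero) → refl ; (fsuc (fsuc fzero)) → refl
                 ; (fsuc (fsuc (fsuc fzero))) → refl ; (fsuc (fsuc (fsuc (fsuc fzero)))) → refl
                 ; (fsuc (fsuc (fsuc (fsuc (fsuc fzero))))) → refl
                 ; (fsuc (fsuc (fsuc (fsuc (fsuc (fsuc fzero)))))) → refl } }

-- The family L₂ (for parameter m), realised on the vertex set Fin (2m+1):
-- the vertex v plays the role of x_{idx v} for idx v ∈ [1,2m], and of x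
-- when idx v = 2m+1.

idx : ∀ {n} → Fin n → ℕ
idx v = suc (toℕ v)

record InL2 (m : ℕ) (H : Digraph (2 * m + 1)) : Set where
  field
    cyc-step : ∀ u v → idx u < 2 * m → idx v ≡ suc (idx u) → Arc H u v
    cyc-close : ∀ u v → idx u ≡ 2 * m → idx v ≡ 1 → Arc H u v
    x-x2m : ∀ u v → idx u ≡ 2 * m + 1 → idx v ≡ 2 * m → ¬ Adjacent H u v
    out-xs : ∀ u v → (idx u ≡ 2 * m + 1 ⊎ idx u ≡ 2 * m) →
             (Arc H u v → idx v ≤ m) × (idx v ≤ m → Arc H u v)
    in-xs : ∀ u v → (idx v ≡ 2 * m + 1 ⊎ idx v ≡ 2 * m) →
            (Arc H u v → m ≤ idx u × idx u ≤ 2 * m ∸ 1) ×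
            (m ≤ idx u × idx u ≤ 2 * m ∸ 1 → Arc H u v)
    no-arc : ∀ u v → idx u ≤ m ∸ 1 → m + 1 ≤ idx v → idx v ≤ 2 * m ∸ 1 →
             arc H u v ≡ false

IsoToL2 : ∀ m → Digraph (2 * m + 1) → Set
IsoToL2 m D = Σ (Digraph (2 * m + 1)) λ H → InL2 m H × Iso D H

-- Symmetric digraphs G* of undirected graphs, on Fin (2m+1); vertices
-- with toℕ v < m form the first part (of size m), the rest the second
-- part (of size m+1).

record Graph (n : ℕ) : Set where
  field
    edge      : Fin n → Fin n → Bool
    symmetric : ∀ u v → edge u v ≡ edge v u
    noloop    : ∀ v → edge v v ≡ false

_* : ∀ {n} → Graph n → Digraph n
G * = record { arc = Graph.edge G ; loopless = Graph.noloop G }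

inA : ∀ {n} → (m : ℕ) → Fin n → Bool
inA m v = Data.Nat._<ᵇ_ (toℕ v) m

private
  xor-comm : ∀ a b → Data.Bool._xor_ a b ≡ Data.Bool._xor_ b a
  xor-comm true true = refl
  xor-comm true false = refl
  xor-comm false true = refl
  xor-comm false false = refl

  xor-self : ∀ a → Data.Bool._xor_ a a ≡ false
  xor-self true = refl
  xor-self false = refl

  eqb-sym : ∀ a b → Data.Nat._≡ᵇ_ a b ≡ Data.Nat._≡ᵇ_ b a
  eqb-sym zero zero = refl
  eqb-sym zero (suc b) = refl
  eqb-sym (suc a) zero = refl
  eqb-sym (suc a) (suc b) = eqb-sym a b

  eqb-refl : ∀ a → Data.Nat._≡ᵇ_ a a ≡ true
  eqb-refl zero = refl
  eqb-refl (suc a) = eqb-refl a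

  andor-sym : ∀ e e' a b → e ≡ e' →
    not e Data.Bool.∧ (a ∨ b) ≡ not e' Data.Bool.∧ (b ∨ a)
  andor-sym e .e true true refl = refl
  andor-sym e .e true false refl = refl
  andor-sym e .e false true refl = refl
  andor-sym e .e false false refl = refl

  andor-refl : ∀ e c → e ≡ true → not e Data.Bool.∧ c ≡ false
  andor-refl .true c refl = refl

Kbip : ∀ m → Graph (2 * m + 1)
Kbip m = record
  { edge = λ u v → Data.Bool._xor_ (inA m u) (inA m v)
  ; symmetric = λ u v → xor-comm (inA m u) (inA m v)
  ; noloop = λ v → xor-self (inA m v) }

-- the join K_m + K̄_{m+1}: K_m on {toℕ v < m}, independent set on the rest,
-- all edges between the two parts
Kjoin : ∀ m → Graph (2 * m + 1)
Kjoin m = record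
  { edge = λ u v → not (Data.Nat._≡ᵇ_ (toℕ u) (toℕ v)) Data.Bool.∧ (inA m u ∨ inA m v)
  ; symmetric = λ u v → andor-sym _ _ (inA m u) (inA m v) (eqb-sym (toℕ u) (toℕ v))
  ; noloop = λ v → andor-refl _ _ (eqb-refl (toℕ v)) }

nonAdjCount : ∀ {n k} {D : Digraph n} → Cycle D k → Fin n → ℕ
nonAdjCount {k = k} {D} C x = countB (λ i → not (adjB D x (cyc C i))) (allFin k)

PropIV : ∀ {n k} (D : Digraph n) → Cycle D k → Set
PropIV {n} D C = ∀ (x : Fin n) → ¬ OnCycle C x → 3 ≤ nonAdjCount C x →
  ∀ i → ¬ Adjacent D x (cyc C i) →
    Arc D (cyc C (cprev i)) x × Arc D x (cyc C (cnext i)) ×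
    (∀ w → arc D x w ≡ arc D (cyc C i) w) ×
    (∀ w → arc D w x ≡ arc D w (cyc C i))

{-# OPTIONS --safe #-}
module Submission where

-- Property (iv) is vacuous for a 2m-cycle whose missing vertex x has at most two non-neighbours, and (i) holds when
-- D is hamiltonian or when x has a semidegree below m. So assume that no 2m-cycle is of these kinds.
-- Counting then gives, for consecutive u, v on a 2m-cycle missing x, exactly one of the arcs u → x and x → v.
-- Hence x can replace any non-neighbour y on the cycle, and the same dichotomy holds for y.
-- On the non-neighbours of x, non-adjacency is transitive. If some non-neighbour y were adjacent to all the others, they
-- would be joined pairwise, even by arcs both ways; then each of them misses two vertices joined both ways to x,
-- different ones for different non-neighbours, but x has no more vertices joined both ways than non-neighbours.
-- So y has a partner z non-adjacent to x and y, and with its help any difference between the neighbourhoods of x and y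
-- yields a Hamiltonian cycle.

open import Defs
open import Data.Nat using (ℕ; _≤_; _+_; _*_)
open import Data.Fin using (Fin)
open import Data.Product using (Σ; _×_)
open import Data.Sum using (_⊎_)

import Algebra.Solver.CommutativeMonoid.Normal
open import Data.Bool using (Bool; true; false; not; _∧_; if_then_else_)
import Data.Bool.Properties as Bool
open import Data.Empty using (⊥; ⊥-elim)
open import Data.Fin using (toℕ; zero; suc)
open import Data.Fin.Patterns using (0F; 1F; 2F; 3F; 4F; 5F; 6F)
open import Data.Fin.Properties using (_≟_; all?; toℕ-fromℕ<; toℕ<n; toℕ-injective)
import Data.Fin.Properties as Fin
open import Data.List using (List; []; _∷_; _++_; [_]; allFin; reverse; map; length; tabulate; initLast; _∷ʳ′_)
open import Data.List.Membership.Propositional using (_∈_; lose; find)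
open import Data.List.Membership.Propositional.Properties using (∈-∃++; ∈-++⁻; ∈-++⁺ʳ; ∈-allFin; ∈-tabulate⁻; ∈-tabulate⁺)
open import Data.List.Properties using (unfold-reverse; ++-assoc; ∷-injectiveˡ; ∷-injectiveʳ; ∷ʳ-injectiveʳ; length-tabulate; map-tabulate)
open import Data.List.Relation.Binary.Permutation.Propositional using (_↭_; ↭-refl; ↭-sym; ↭-trans; ↭-prep; ↭-swap; ↭-reflexive; ↭⇒↭ₛ)
open import Data.List.Relation.Binary.Permutation.Propositional.Properties using (++-commutativeMonoid; ∈-resp-↭; ↭-reverse; ↭-length; ++-comm; ++⁺; map⁺; shift; ∷↭∷ʳ)
import Data.List.Relation.Binary.Permutation.Setoid.Properties as ↭ₛ
import Data.List.Relation.Unary.All as All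
open import Data.List.Relation.Unary.AllPairs using (_∷_)
open import Data.List.Relation.Unary.Any using (here; there; any?)
open import Data.List.Relation.Unary.Unique.Propositional using (Unique)
open import Data.List.Relation.Unary.Unique.Propositional.Properties using (allFin⁺; tabulate⁺)
open import Data.Nat using (zero; suc; _<_; z≤n; s≤s)
open import Data.Nat.DivMod using (_mod_; _%_; %-distribˡ-+; m<n⇒m%n≡m; n%n≡0; [m+n]%n≡m%n; m%n%n≡m%n; m%n<n)
open import Data.Nat.ListAction using (sum)
open import Data.Nat.ListAction.Properties using (sum-↭)
open import Data.Nat.Properties hiding (_≟_)
open import Data.Nat.Solver using (module +-*-Solver)
open import Data.Product using (∃; _,_; proj₁; proj₂; swap)
open import Data.Sum as Sum using (inj₁; inj₂)
open import Data.Vec as Vec using (Vec; _∷_; [])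
open import Function using (_∘_; case_of_)
open import Relation.Binary.PropositionalEquality using (_≡_; _≢_; refl; sym; trans; cong; cong₂; subst; subst₂; setoid; module ≡-Reasoning)
open import Relation.Nullary using (¬_; Dec; yes; no; contradiction)
open import Relation.Nullary.Decidable using (decidable-stable; True; toWitness; map′; ¬?; _×-dec_; _→-dec_)

-- Directed paths and cycles missing one vertex

module Segments {n} (D : Digraph n) where

  V : Set
  V = Fin n

  Arc? : ∀ u v → Dec (Arc D u v)
  Arc? u v = arc D u v Bool.≟ true

  no-loop : ∀ {v} → ¬ Arc D v v
  no-loop {v} p with trans (sym p) (loopless D v)
  ... | ()

  NonAdj : V → V → Set
  NonAdj u v = ¬ Arc D u v × ¬ Arc D v u

  -- Distinctness of the vertices is not recorded: it follows wherever the list is, up to order,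
  -- part of `allFin n`.
  data Seg : V → List V → V → Set where
    one  : ∀ {v} → Seg v [ v ] v
    cons : ∀ {u v xs w} → Arc D u v → Seg v xs w → Seg u (u ∷ xs) w

  join : ∀ {a xs b c ys d} → Seg a xs b → Arc D b c → Seg c ys d → Seg a (xs ++ ys) d
  join one        r t = cons r t
  join (cons p s) r t = cons p (join s r t)

  record Piece : Set where
    constructor piece
    field
      {first last} : V
      {verts}      : List V
      seg          : Seg first verts last
  open Piece public

  infix  4 _⟶_
  infixr 5 link

  _⟶_ : Piece → Piece → Set
  X ⟶ Y = Arc D (last X) (first Y)

  pt : V → Piece
  pt v = piece (one {v})

  link : (X Y : Piece) → X ⟶ Y → Piece
  link X Y r = piece (join (seg X) r (seg Y))

  syntax link X Y r = X ▸⟨ r ⟩ Y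

  -- gap: x cannot be inserted between the ends of X, so by counting exactly one of the two arcs is present.
  record Rigid : Set where
    field
      no-ham : ∀ X → X ⟶ X → ¬ (verts X ↭ allFin n)
      gap    : ∀ {x} X → X ⟶ X → x ∷ verts X ↭ allFin n →
               ¬ Arc D (last X) x → Arc D x (first X)

  -- The cycle y A z B w C of length n - 1, missing x.
  record Config (A B C : Piece) (x y z w : V) : Set where
    constructor config
    field
      y→A : pt y ⟶ A
      A→z : A ⟶ pt z
      z→B : pt z ⟶ B
      B→w : B ⟶ pt w
      w→C : pt w ⟶ C
      C→y : C ⟶ pt y
      all : x ∷ y ∷ verts A ++ z ∷ verts B ++ w ∷ verts C ↭ allFin n
  open Config public

  module Sol = Algebra.Solver.CommutativeMonoid.Normal (++-commutativeMonoid {A = V})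
  open Sol using (Expr; var; ⟦_⟧; normalise)
  open Sol public using (_⊕_)

  𝔸 𝔹 ℂ 𝕩 𝕪 𝕫 𝕨 : Expr 7
  𝔸 = var 0F
  𝔹 = var 1F
  ℂ = var 2F
  𝕩 = var 3F
  𝕪 = var 4F
  𝕫 = var 5F
  𝕨 = var 6F

  standard : Expr 7
  standard = 𝕩 ⊕ 𝕪 ⊕ 𝔸 ⊕ 𝕫 ⊕ 𝔹 ⊕ 𝕨 ⊕ ℂ

  -- Lists up to `↭` form a commutative monoid under `++`. Both expressions normalise to the same
  -- multiset of variables, and the implicit `True` argument lets this be checked by computation.
  reorder : ∀ (e : Expr 7) ρ {_ : True (normalise e Sol.≟ normalise standard)} →
            ⟦ e ⟧ ρ ↭ ⟦ standard ⟧ ρ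
  reorder e ρ {eq} = ↭-trans (↭-sym (Sol.correct e ρ))
    (subst (λ e′ → Sol.⟦ e′ ⟧⇓ ρ ↭ ⟦ standard ⟧ ρ) (sym (toWitness eq)) (Sol.correct standard ρ))

  env : (A B C : Piece) (x y z w : V) → Sol.Env 7
  env A B C x y z w = verts A ∷ verts B ∷ verts C ∷ [ x ] ∷ [ y ] ∷ [ z ] ∷ [ w ] ∷ []

  -- The same cycle is read from z on, so each fact about y yields the corresponding facts about z
  -- and w.
  rotate : ∀ {A B C x y z w} → Config A B C x y z w → Config B C A x z w y
  rotate {A} {B} {C} {x} {y} {z} {w} c = config (z→B c) (B→w c) (w→C c) (C→y c) (y→A c) (A→z c)
    (↭-trans (reorder (𝕩 ⊕ 𝕫 ⊕ 𝔹 ⊕ 𝕨 ⊕ ℂ ⊕ 𝕪 ⊕ 𝔸) (env A B C x y z w)) (all c))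

  -- Hamiltonian cycles assembled from three pieces

  module Hamiltonian (R : Rigid) where
    open Rigid R

    module _ {A B C x y z w} (c : Config A B C x y z w) where

      -- The last vertex of C and y are consecutive on the cycle, so `gap` at this place leaves no
      -- other choice.
      in-y : ¬ Arc D x y → C ⟶ pt x
      in-y ¬xy = decidable-stable (Arc? _ _) λ ¬Cx → ¬xy (gap
        (pt y ▸⟨ y→A c ⟩ A ▸⟨ A→z c ⟩ pt z ▸⟨ z→B c ⟩ B ▸⟨ B→w c ⟩ pt w ▸⟨ w→C c ⟩ C) (C→y c) (all c) ¬Cx)

      out-y : ¬ Arc D y x → pt x ⟶ A
      out-y = gap (A ▸⟨ A→z c ⟩ pt z ▸⟨ z→B c ⟩ B ▸⟨ B→w c ⟩ pt w ▸⟨ w→C c ⟩ C ▸⟨ C→y c ⟩ pt y) (y→A c)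
        (↭-trans (reorder (𝕩 ⊕ 𝔸 ⊕ 𝕫 ⊕ 𝔹 ⊕ 𝕨 ⊕ ℂ ⊕ 𝕪) (env A B C x y z w)) (all c))

      ham : ∀ (e : Expr 7) {_ : True (normalise e Sol.≟ normalise standard)} →
            ∀ X → X ⟶ X → verts X ≡ ⟦ e ⟧ (env A B C x y z w) → ⊥
      ham e {p} X r eq = no-ham X r
        (subst (_↭ allFin n) (sym eq) (↭-trans (reorder e (env A B C x y z w) {p}) (all c)))

    module _ {A B C x y z w} (c : Config A B C x y z w) where

      in-z : ¬ Arc D x z → A ⟶ pt x
      in-z = in-y (rotate c)

      out-z : ¬ Arc D z x → pt x ⟶ B
      out-z = out-y (rotate c)

      in-w : ¬ Arc D x w → B ⟶ pt x
      in-w = in-y (rotate (rotate c))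

      out-w : ¬ Arc D w x → pt x ⟶ C
      out-w = out-y (rotate (rotate c))

      -- x takes the place of y: the dichotomy just before y and just after y supplies the two new
      -- arcs.
      swap-y : NonAdj x y → Config A B C y x z w
      swap-y (¬xy , ¬yx) = config (out-y c ¬yx) (A→z c) (z→B c) (B→w c) (w→C c) (in-y c ¬xy)
        (↭-trans (reorder (𝕪 ⊕ 𝕩 ⊕ 𝔸 ⊕ 𝕫 ⊕ 𝔹 ⊕ 𝕨 ⊕ ℂ) (env A B C x y z w)) (all c))

    -- As y and w are non-adjacent, w dominates the start of A (from the cycle missing w), and y
    -- dominates the start of C (from the cycle missing y). With these arcs, an arc between y and z
    -- in either direction closes a Hamiltonian cycle.
    nonAdj-transitive : ∀ {A B C x y z w} → Config A B C x y z w →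
      NonAdj x y → NonAdj x z → NonAdj x w → NonAdj y w → NonAdj y z
    nonAdj-transitive {A} {B} {C} {x} {y} {z} {w} c xy (xz , zx) xw (yw , wy) = no-yz , no-zy
      where
      cy = swap-y c xy
      cw = swap-y (rotate (rotate c)) xw
      no-yz : ¬ Arc D y z
      no-yz yz = ham c (ℂ ⊕ 𝕪 ⊕ 𝕫 ⊕ 𝔹 ⊕ 𝕨 ⊕ 𝔸 ⊕ 𝕩)
        (C ▸⟨ C→y c ⟩ pt y ▸⟨ yz ⟩ pt z ▸⟨ z→B c ⟩ B ▸⟨ B→w c ⟩ pt w ▸⟨ out-z cw yw ⟩ A ▸⟨ in-z c xz ⟩ pt x)
        (out-w c (proj₂ xw)) refl
      no-zy : ¬ Arc D z y
      no-zy zy = ham c (𝔸 ⊕ 𝕫 ⊕ 𝕪 ⊕ ℂ ⊕ 𝕩 ⊕ 𝔹 ⊕ 𝕨)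
        (A ▸⟨ A→z c ⟩ pt z ▸⟨ zy ⟩ pt y ▸⟨ out-w cy wy ⟩ C ▸⟨ in-y c (proj₁ xy) ⟩ pt x ▸⟨ out-z c zx ⟩ B ▸⟨ B→w c ⟩ pt w)
        (out-z cw yw) refl

    -- If w did not dominate z, the cycle missing w would give an arc from the end of A to w, and
    -- the arc from y to z would then lie on a Hamiltonian cycle.
    triple : ∀ {A B C x y z w} → Config A B C x y z w →
      NonAdj x y → NonAdj x z → NonAdj x w → Arc D y z → Arc D w z
    triple {A} {B} {C} {x} {y} {z} {w} c xy xz xw yz = decidable-stable (Arc? w z) λ ¬wz →
      ham c (ℂ ⊕ 𝕪 ⊕ 𝕫 ⊕ 𝔹 ⊕ 𝕩 ⊕ 𝔸 ⊕ 𝕨)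
        (C ▸⟨ C→y c ⟩ pt y ▸⟨ yz ⟩ pt z ▸⟨ z→B c ⟩ B ▸⟨ in-w c (proj₁ xw) ⟩ pt x ▸⟨ out-y c (proj₂ xy) ⟩ A
           ▸⟨ in-w (swap-y (rotate (rotate c)) xw) ¬wz ⟩ pt w)
        (w→C c) refl

    -- v is a non-neighbour of y, so v is missed by the cycle with x in the place of y and y in the place of v.
    module Cross {A B C x y z v} (c : Config A B C x y z v)
                 (xy : NonAdj x y) (xz : NonAdj x z) (yv : NonAdj y v) where

      cy : Config A B C y x z v
      cy = swap-y c xy
      cz : Config B C A z x v y
      cz = swap-y (rotate c) xz
      cv : Config C A B v y x z
      cv = swap-y (rotate (rotate cy)) yv

      ¬z→v : ¬ Arc D z v
      ¬z→v zv = ham c (𝔸 ⊕ 𝕫 ⊕ 𝕨 ⊕ ℂ ⊕ 𝕩 ⊕ 𝔹 ⊕ 𝕪)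
        (A ▸⟨ A→z c ⟩ pt z ▸⟨ zv ⟩ pt v ▸⟨ w→C c ⟩ C ▸⟨ in-y c (proj₁ xy) ⟩ pt x
           ▸⟨ out-z c (proj₂ xz) ⟩ B ▸⟨ in-w cy (proj₁ yv) ⟩ pt y) (y→A c) refl

      zy⇒xv : Arc D z y → Arc D x v
      zy⇒xv zy = decidable-stable (Arc? x v) λ ¬xv →
        ham c (𝔸 ⊕ 𝕫 ⊕ 𝕪 ⊕ ℂ ⊕ 𝕩 ⊕ 𝔹 ⊕ 𝕨)
        (A ▸⟨ A→z c ⟩ pt z ▸⟨ zy ⟩ pt y ▸⟨ out-w cy (proj₂ yv) ⟩ C ▸⟨ in-y c (proj₁ xy) ⟩ pt x
           ▸⟨ out-z c (proj₂ xz) ⟩ B ▸⟨ B→w c ⟩ pt v) (out-z cv ¬xv) refl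

      xv⇒zy : Arc D x v → Arc D z y
      xv⇒zy xv = decidable-stable (Arc? z y) λ ¬zy →
        ham c (𝔸 ⊕ 𝕩 ⊕ 𝕨 ⊕ ℂ ⊕ 𝕫 ⊕ 𝔹 ⊕ 𝕪)
        (A ▸⟨ in-z c (proj₁ xz) ⟩ pt x ▸⟨ xv ⟩ pt v ▸⟨ w→C c ⟩ C ▸⟨ in-w cz ¬zy ⟩ pt z
           ▸⟨ z→B c ⟩ B ▸⟨ in-w cy (proj₁ yv) ⟩ pt y) (y→A c) refl

      -- If only the arc from z to y were present, x would dominate v, and the dichotomies for x, y,
      -- z and v would supply the other new arcs of a Hamiltonian cycle.
      y→z : Arc D y z ⊎ Arc D z y → Arc D y z
      y→z (inj₁ yz) = yz
      y→z (inj₂ zy) = decidable-stable (Arc? y z) λ ¬yz →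
        ham c (ℂ ⊕ 𝕩 ⊕ 𝕨 ⊕ 𝔹 ⊕ 𝕫 ⊕ 𝔸 ⊕ 𝕪)
        (C ▸⟨ in-y c (proj₁ xy) ⟩ pt x ▸⟨ zy⇒xv zy ⟩ pt v ▸⟨ out-w cv ¬z→v ⟩ B ▸⟨ in-z cz ¬z→v ⟩ pt z
           ▸⟨ out-w cz ¬yz ⟩ A ▸⟨ in-z cy ¬yz ⟩ pt y) (out-w cy (proj₂ yv)) refl

      v→x : Arc D x v ⊎ Arc D v x → Arc D v x
      v→x (inj₂ vx) = vx
      v→x (inj₁ xv) = decidable-stable (Arc? v x) λ ¬vx →
        ham c (𝔸 ⊕ 𝕩 ⊕ ℂ ⊕ 𝕨 ⊕ 𝔹 ⊕ 𝕫 ⊕ 𝕪)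
        (A ▸⟨ in-z c (proj₁ xz) ⟩ pt x ▸⟨ out-w c ¬vx ⟩ C ▸⟨ in-z cv ¬vx ⟩ pt v ▸⟨ out-w cv ¬z→v ⟩ B
           ▸⟨ in-z cz ¬z→v ⟩ pt z ▸⟨ xv⇒zy xv ⟩ pt y) (y→A c) refl

      -- Otherwise z would dominate the start of C, which closes a Hamiltonian cycle through the arc
      -- from x to v.
      v→z : Arc D x v → Arc D v z
      v→z xv = decidable-stable (Arc? v z) λ ¬vz →
        ham c (ℂ ⊕ 𝕩 ⊕ 𝕨 ⊕ 𝔹 ⊕ 𝕪 ⊕ 𝔸 ⊕ 𝕫)
        (C ▸⟨ in-y c (proj₁ xy) ⟩ pt x ▸⟨ xv ⟩ pt v ▸⟨ out-w cv ¬z→v ⟩ B ▸⟨ in-w cy (proj₁ yv) ⟩ pt y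
           ▸⟨ y→A c ⟩ A ▸⟨ A→z c ⟩ pt z) (out-z cz ¬vz) refl

-- Positions in lists without repetition

Unique-resp-↭ : ∀ {A : Set} {xs ys : List A} → xs ↭ ys → Unique xs → Unique ys
Unique-resp-↭ {A} p = ↭ₛ.Unique-resp-↭ (setoid A) (↭⇒↭ₛ p)

module _ {A : Set} where

  split-unique : ∀ {v : A} as as′ {bs bs′} → Unique (as ++ v ∷ bs) →
                 as ++ v ∷ bs ≡ as′ ++ v ∷ bs′ → as ≡ as′ × bs ≡ bs′
  split-unique [] [] _ refl = refl , refl
  split-unique [] (u ∷ as′) (v∉ ∷ _) refl = contradiction refl (All.lookup v∉ (∈-++⁺ʳ as′ (here refl)))
  split-unique (u ∷ as) [] (u∉ ∷ _) refl = contradiction refl (All.lookup u∉ (∈-++⁺ʳ as (here refl)))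
  split-unique (u ∷ as) (u′ ∷ as′) (_ ∷ p) eq with ∷-injectiveˡ eq | split-unique as as′ p (∷-injectiveʳ eq)
  ... | refl | refl , q = refl , q

  next-unique : ∀ {u v w : A} {as as′ bs bs′ xs} → Unique xs →
                xs ≡ as ++ u ∷ v ∷ bs → xs ≡ as′ ++ u ∷ w ∷ bs′ → v ≡ w
  next-unique {as = as} {as′} p refl eq = ∷-injectiveˡ (proj₂ (split-unique as as′ p eq))

  previous-unique : ∀ {u v w : A} as as′ {bs bs′ xs} → Unique xs →
                    xs ≡ as ++ v ∷ u ∷ bs → xs ≡ as′ ++ w ∷ u ∷ bs′ → v ≡ w
  previous-unique {u} {v} {w} as as′ {bs} {bs′} p refl eq
    -- The predecessor is moved into the prefix, so that both lists are split at u.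
    with split-unique (as ++ [ v ]) (as′ ++ [ w ]) {bs} {bs′}
           (subst Unique (sym (++-assoc as [ v ] (u ∷ bs))) p)
           (trans (++-assoc as [ v ] (u ∷ bs)) (trans eq (sym (++-assoc as′ [ w ] (u ∷ bs′)))))
  ... | q , _ = ∷ʳ-injectiveʳ as as′ q

  split-two : ∀ {u v : A} {xs} → u ∈ xs → v ∈ xs → u ≢ v →
              (∃ λ as → ∃ λ bs → ∃ λ cs → xs ≡ as ++ u ∷ bs ++ v ∷ cs) ⊎
              (∃ λ as → ∃ λ bs → ∃ λ cs → xs ≡ as ++ v ∷ bs ++ u ∷ cs)
  split-two {u} {v} u∈ v∈ u≢v with ∈-∃++ u∈
  ... | as , bs , refl with ∈-++⁻ as v∈
  ...   | inj₂ (here v≡u) = contradiction (sym v≡u) u≢v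
  ...   | inj₂ (there v∈bs) with ∈-∃++ v∈bs
  ...     | bs′ , cs , refl = inj₁ (as , bs′ , cs , refl)
  split-two {u} {v} u∈ v∈ u≢v | as , bs , refl | inj₁ v∈as with ∈-∃++ v∈as
  ...     | as′ , bs′ , refl = inj₂ (as′ , bs′ , bs , ++-assoc as′ (v ∷ bs′) (u ∷ bs))

-- Reversing all arcs

_ᵒ : ∀ {n} → Digraph n → Digraph n
D ᵒ = record { arc = λ u v → arc D v u ; loopless = loopless D }

module Reversal {n} (D : Digraph n) where

  open Segments D
  module Op = Segments (D ᵒ)

  seg-reverse : ∀ {a xs b} → Seg a xs b → Op.Seg b (reverse xs) a
  seg-reverse one = Op.one
  seg-reverse (cons {u = u} {xs = xs} r s) =
    subst (λ ys → Op.Seg _ ys _) (sym (unfold-reverse u xs)) (Op.join (seg-reverse s) r Op.one)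

  piece-reverse : Piece → Op.Piece
  piece-reverse X = Op.piece (seg-reverse (seg X))

  config-reverse : ∀ {A B C x y z w} → Config A B C x y z w →
    Op.Config (piece-reverse C) (piece-reverse B) (piece-reverse A) x y w z
  config-reverse {A} {B} {C} {x} {y} {z} {w} c = Op.config (C→y c) (w→C c) (B→w c) (z→B c) (A→z c) (y→A c)
    (↭-trans (↭-prep x (↭-prep y (++⁺ (↭-reverse (verts C)) (↭-prep w (++⁺ (↭-reverse (verts B)) (↭-prep z (↭-reverse (verts A))))))))
      (↭-trans (reorder (𝕩 ⊕ 𝕪 ⊕ ℂ ⊕ 𝕨 ⊕ 𝔹 ⊕ 𝕫 ⊕ 𝔸) (env A B C x y z w)) (all c)))

-- Reversal swaps the two alternatives of `gap`, and decidability of arcs makes the two forms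
-- equivalent. Hence every consequence of rigidity also holds in mirrored form.
rigid-reverse : ∀ {n} (D : Digraph n) → Segments.Rigid D → Segments.Rigid (D ᵒ)
rigid-reverse D R = record
  { no-ham = λ X r p → no-ham (piece-reverse X) r (↭-trans (↭-reverse (Op.verts X)) p)
  ; gap = λ {x} X r p ¬b → decidable-stable (Op.Arc? _ _) λ ¬a →
      ¬b (gap (piece-reverse X) r (↭-trans (↭-prep x (↭-reverse (Op.verts X))) p) ¬a) }
  where
  open Segments.Rigid R
  open Reversal (D ᵒ) using (piece-reverse)
  module Op = Segments (D ᵒ)

-- Circuits missing one vertex

module Walks {n} (D : Digraph n) where

  open Segments D

  -- Unlike in `Seg`, the list holds only the vertices between the ends, so a closed walk at y has
  -- exactly the vertices `y ∷ xs`.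
  data Walk : V → List V → V → Set where
    step : ∀ {u v} → Arc D u v → Walk u [] v
    _∷_  : ∀ {u v xs w} → Arc D u v → Walk v xs w → Walk u (v ∷ xs) w

  walk-++ : ∀ {u xs v ys w} → Walk u xs v → Walk v ys w → Walk u (xs ++ v ∷ ys) w
  walk-++ (step r) q = r ∷ q
  walk-++ (r ∷ p)  q = r ∷ walk-++ p q

  walk-split : ∀ {u w} xs {v ys} → Walk u (xs ++ v ∷ ys) w → Walk u xs v × Walk v ys w
  walk-split []       (r ∷ p) = step r , p
  walk-split (x ∷ xs) (r ∷ p) with walk-split xs p
  ... | q , q′ = (r ∷ q) , q′

  walk⇒seg : ∀ {u xs v} → Walk u xs v → Seg u (u ∷ xs ++ [ v ]) v
  walk⇒seg (step r) = cons r one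
  walk⇒seg (r ∷ p)  = cons r (walk⇒seg p)

  seg⇒walk : ∀ {u a xs b v} → Arc D u a → Seg a xs b → Arc D b v → Walk u xs v
  seg⇒walk r one        t = r ∷ step t
  seg⇒walk r (cons p s) t = r ∷ seg⇒walk p s t

  record Interior (u : V) (xs : List V) (v : V) : Set where
    field
      interior : Piece
      enter    : pt u ⟶ interior
      leave    : interior ⟶ pt v
      verts≡   : verts interior ≡ xs

  walk⇒interior : ∀ {u x xs v} → Walk u (x ∷ xs) v → Interior u (x ∷ xs) v
  walk⇒interior (r ∷ step t) = record { interior = pt _ ; enter = r ; leave = t ; verts≡ = refl }
  walk⇒interior (r ∷ (t ∷ p)) with walk⇒interior (t ∷ p)
  ... | record { interior = X ; enter = e ; leave = l ; verts≡ = eq } =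
    record { interior = pt _ ▸⟨ e ⟩ X ; enter = r ; leave = l ; verts≡ = cong (_ ∷_) eq }

  -- A cycle through all vertices except x, cut open at y.
  record Circuit (x y : V) (ps : List V) : Set where
    constructor circuit
    field
      walk : Walk y ps y
      all  : x ∷ y ∷ ps ↭ allFin n

  rebase : ∀ {x y z} as {bs} → Circuit x y (as ++ z ∷ bs) → Circuit x z (bs ++ y ∷ as)
  rebase {x} {y} {z} as {bs} (circuit p σ) with walk-split as p
  ... | q , q′ = circuit (walk-++ q′ q) (↭-trans (↭-prep x (++-comm (z ∷ bs) (y ∷ as))) σ)

  module _ {x y ps} (c : Circuit x y ps) where

    circuit-unique : Unique (x ∷ y ∷ ps)
    circuit-unique = Unique-resp-↭ (↭-sym (Circuit.all c)) (allFin⁺ n)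

    interior-unique : Unique ps
    interior-unique with circuit-unique
    ... | _ ∷ _ ∷ q = q

    on-circuit : ∀ {v} → v ≢ x → v ≢ y → v ∈ ps
    on-circuit {v} v≢x v≢y with ∈-resp-↭ (↭-sym (Circuit.all c)) (∈-allFin v)
    ... | here v≡x = contradiction v≡x v≢x
    ... | there (here v≡y) = contradiction v≡y v≢y
    ... | there (there v∈) = v∈

    off≢base : x ≢ y
    off≢base with circuit-unique
    ... | q ∷ _ = All.lookup q (here refl)

    off≢interior : ∀ {v} → v ∈ ps → v ≢ x
    off≢interior v∈ v≡x with circuit-unique
    ... | q ∷ _ = All.lookup q (there v∈) (sym v≡x)

    base≢interior : ∀ {v} → v ∈ ps → v ≢ y
    base≢interior v∈ v≡y with circuit-unique
    ... | _ ∷ q ∷ _ = All.lookup q v∈ (sym v≡y)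

  module Rules (R : Rigid) where
    open Rigid R

    after : ∀ {x y p ps} → Circuit x y (p ∷ ps) → ¬ Arc D y x → Arc D x p
    after {x} {y} {p} {ps} (circuit (r ∷ q) σ) = gap (piece (walk⇒seg q)) r
      (↭-trans (↭-prep x (++-comm (p ∷ ps) [ y ])) σ)

    no-consecutive : ∀ {x y p ps} → Circuit x y (p ∷ ps) → NonAdj x y → ¬ NonAdj x p
    no-consecutive c (_ , ¬yx) (¬xp , _) = ¬xp (after c ¬yx)

    -- The form of `swap-y` for circuits, where no third or fourth vertex has to be singled out.
    exchange : ∀ {x y ps} → Circuit x y ps → NonAdj x y → Circuit y x ps
    exchange {ps = []} (circuit (step r) _) _ = ⊥-elim (no-loop r)
    exchange {x} {y} {p ∷ ps} (circuit q σ) (¬xy , ¬yx) with walk⇒interior q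
    ... | record { interior = X ; enter = e ; leave = l ; verts≡ = eq } =
      circuit (subst (λ vs → Walk x vs x) eq (seg⇒walk xX (seg X) Xx)) (↭-trans (↭-swap y x ↭-refl) σ)
      where
      σ′ = subst (λ vs → x ∷ y ∷ vs ↭ allFin n) (sym eq) σ
      xX = gap (X ▸⟨ l ⟩ pt y) e (↭-trans (↭-prep x (++-comm (verts X) [ y ])) σ′) ¬yx
      Xx = decidable-stable (Arc? _ _) λ ¬Xx → ¬xy (gap (pt y ▸⟨ e ⟩ X) l σ′ ¬Xx)

    ∃Config : (x y z w : V) → Set
    ∃Config x y z w = ∃ λ A → ∃ λ B → ∃ λ C → Config A B C x y z w

    make-config : ∀ {x y z w} as bs {cs} → Circuit x y (as ++ z ∷ bs ++ w ∷ cs) →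
                  as ≢ [] → bs ≢ [] → cs ≢ [] → ∃Config x y z w
    make-config {x} {y} {z} {w} as bs {cs} (circuit p σ) = λ as≢ bs≢ cs≢ →
      go (proj₁ (walk-split as p)) (proj₁ (walk-split bs (proj₂ (walk-split as p))))
         (proj₂ (walk-split bs (proj₂ (walk-split as p)))) σ as≢ bs≢ cs≢
      where
      go : ∀ {as bs cs} → Walk y as z → Walk z bs w → Walk w cs y → x ∷ y ∷ as ++ z ∷ bs ++ w ∷ cs ↭ allFin n →
           as ≢ [] → bs ≢ [] → cs ≢ [] → ∃Config x y z w
      go {[]} _ _ _ _ as≢ _ _ = contradiction refl as≢
      go {_ ∷ _} {[]} _ _ _ _ _ bs≢ _ = contradiction refl bs≢
      go {_ ∷ _} {_ ∷ _} {[]} _ _ _ _ _ _ cs≢ = contradiction refl cs≢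
      go {_ ∷ _} {_ ∷ _} {_ ∷ _} p q r τ _ _ _ with walk⇒interior p | walk⇒interior q | walk⇒interior r
      ... | record { interior = A ; enter = yA ; leave = Az ; verts≡ = refl }
          | record { interior = B ; enter = zB ; leave = Bw ; verts≡ = refl }
          | record { interior = C ; enter = wC ; leave = Cy ; verts≡ = refl } =
        A , B , C , config yA Az zB Bw wC Cy τ

walk-reverse : ∀ {n} (D : Digraph n) {u xs v} → Walks.Walk D u xs v → Walks.Walk (D ᵒ) v (reverse xs) u
walk-reverse D (Walks.step r) = Walks.step r
walk-reverse D (Walks._∷_ {xs = xs} r p) = subst (λ ys → Walk _ ys _) (sym (unfold-reverse _ xs))
  (walk-++ (walk-reverse D p) (step r))
  where open Walks (D ᵒ)

circuit-reverse : ∀ {n} (D : Digraph n) {x y ps} → Walks.Circuit D x y ps → Walks.Circuit (D ᵒ) x y (reverse ps)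
circuit-reverse D (Walks.circuit p σ) = Walks.circuit (walk-reverse D p)
  (↭-trans (↭-prep _ (↭-prep _ (↭-reverse _))) σ)

-- Arcs at the non-neighbours of the missing vertex

module Structure {n} (D : Digraph n) (R : Segments.Rigid D) where

  open Segments D
  open Hamiltonian R
  open Walks D
  open Rules R
  open Reversal D using (config-reverse)
  private
    module Oᴴ = Segments.Hamiltonian (D ᵒ) (rigid-reverse D R)

  ends-at-base : ∀ {x y z} as {bs} {w} {cs} → Circuit x y (as ++ z ∷ bs ++ w ∷ cs) → cs ≡ [] → Circuit x w (y ∷ as ++ z ∷ bs)
  ends-at-base {x} {y} {z} as {bs} c refl = rebase (as ++ z ∷ bs) (subst (Circuit x y) (sym (++-assoc as (z ∷ bs) _)) c)

  first-arc : ∀ {x y p ps} → Circuit x y (p ∷ ps) → Arc D y p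
  first-arc (circuit (r ∷ _) _) = r

  -- Two consecutive vertices are never both non-neighbours of x, so all three pieces between y, z
  -- and w are non-empty.
  separate : ∀ {x y z w} as bs {cs} → Circuit x y (as ++ z ∷ bs ++ w ∷ cs) →
             NonAdj x y → NonAdj x z → NonAdj x w → ∃Config x y z w
  separate as bs c xy xz xw = make-config as bs c
    (λ { refl → no-consecutive c xy xz })
    (λ { refl → no-consecutive (rebase as c) xz xw })
    (λ cs≡ → no-consecutive (ends-at-base as c cs≡) xw xy)

  -- If w comes before z on the circuit, reversing all arcs restores the cyclic order y, z, w.
  nonAdj-trans : ∀ {x y ps z w} → Circuit x y ps → z ∈ ps → w ∈ ps → z ≢ w →
    NonAdj x y → NonAdj x z → NonAdj x w → NonAdj y w → NonAdj y z
  nonAdj-trans c z∈ w∈ z≢w xy xz xw yw with split-two z∈ w∈ z≢w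
  ... | inj₁ (as , bs , cs , refl) with separate as bs c xy xz xw
  ...   | _ , _ , _ , k = nonAdj-transitive k xy xz xw yw
  nonAdj-trans c z∈ w∈ z≢w xy xz xw yw | inj₂ (as , bs , cs , refl) with separate as bs c xy xw xz
  ...   | _ , _ , _ , k = swap (Oᴴ.nonAdj-transitive (config-reverse k) (swap xy) (swap xz) (swap xw) (swap yw))

  -- The Hamiltonian cycles behind `apart` need z and v not to be consecutive on the circuit.
  data Crossing (x y z v : V) (ps : List V) : Set where
    apart  : (Arc D z y → Arc D x v) → (Arc D x v → Arc D z y) →
             (Arc D y z → Arc D v x) → (Arc D v x → Arc D y z) →
             (Arc D x v → Arc D v x → Arc D z v ⊎ Arc D v z) → Crossing x y z v ps
    before : ∀ as bs → ps ≡ as ++ z ∷ v ∷ bs → Arc D x v → Arc D z y → Arc D z v → Crossing x y z v ps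
    behind : ∀ as bs → ps ≡ as ++ v ∷ z ∷ bs → Arc D v x → Arc D y z → Arc D v z → Crossing x y z v ps

  module Crosses {x y ps} (c : Circuit x y ps) (xy : NonAdj x y) where

    differ : ∀ {z v} → NonAdj x z → Arc D x v ⊎ Arc D v x → z ≢ v
    differ xz xv refl = Sum.[ proj₁ xz , proj₂ xz ] xv

    -- The piece from y to z is non-empty because both are non-neighbours of x, and the piece from v
    -- to y because v does not dominate y.
    config-zv : ∀ {z v} as p bs {cs} → ps ≡ as ++ z ∷ (p ∷ bs) ++ v ∷ cs → NonAdj x z → NonAdj y v → ∃Config x y z v
    config-zv as p bs refl xz yv = make-config as (p ∷ bs) c
      (λ { refl → no-consecutive c xy xz }) (λ ())
      (λ cs≡ → proj₂ yv (first-arc (ends-at-base as {bs = p ∷ bs} c cs≡)))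

    config-vz : ∀ {z v} as p bs {cs} → ps ≡ as ++ v ∷ (p ∷ bs) ++ z ∷ cs → NonAdj x z → NonAdj y v → ∃Config x y v z
    config-vz as p bs refl xz yv = make-config as (p ∷ bs) c
      (λ { refl → proj₁ yv (first-arc c) }) (λ ())
      (λ cs≡ → no-consecutive (ends-at-base as {bs = p ∷ bs} c cs≡) xz xy)

    vz⇒xv : ∀ {z v} as p bs {cs} → ps ≡ as ++ v ∷ (p ∷ bs) ++ z ∷ cs → NonAdj x z → NonAdj y v →
            Arc D x v ⊎ Arc D v x → Arc D x v
    vz⇒xv as p bs eq xz yv xv with config-vz as p bs eq xz yv
    ... | _ , _ , _ , k = v→x (Sum.swap xv)
      where open Oᴴ.Cross (config-reverse k) (swap xy) (swap xz) (swap yv)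

    -- Four positions occur: z or v comes first, and the two are consecutive or not. When v comes
    -- first and they are not consecutive, `Cross` is applied to the reversed digraph.
    crossing : ∀ {z v} → z ∈ ps → v ∈ ps → NonAdj x z → NonAdj y v →
               Arc D y z ⊎ Arc D z y → Arc D x v ⊎ Arc D v x → Crossing x y z v ps
    crossing z∈ v∈ xz yv yz xv with split-two z∈ v∈ (differ xz xv)
    -- Here v follows z directly. Since z does not dominate x, x dominates v; since y does not
    -- dominate v, the circuit missing y shows that z dominates y.
    ... | inj₁ (as , [] , cs , refl) = before as cs refl (after (rebase as c) (proj₂ xz))
          (decidable-stable (Arc? _ _) λ ¬zy → proj₁ yv (after (rebase as (exchange c xy)) ¬zy))
          (first-arc (rebase as c))
    ... | inj₂ (as , [] , cs , refl) = behind as cs refl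
          (decidable-stable (Arc? _ _) λ ¬vx → proj₁ xz (after (rebase as c) ¬vx))
          (after (rebase as (exchange c xy)) (proj₂ yv))
          (first-arc (rebase as c))
    ... | inj₁ (as , p ∷ bs , cs , eq) with config-zv as p bs eq xz yv
    ...   | _ , _ , _ , k = apart zy⇒xv xv⇒zy (λ _ → v→x xv) (λ _ → y→z yz) (λ xv _ → inj₂ (v→z xv))
      where open Cross k xy xz yv
    crossing z∈ v∈ xz yv yz xv | inj₂ (as , p ∷ bs , cs , eq) with config-vz as p bs eq xz yv
    ...   | _ , _ , _ , k = apart (λ _ → v→x (Sum.swap xv)) (λ _ → y→z (Sum.swap yz)) zy⇒xv xv⇒zy (λ _ vx → inj₁ (v→z vx))
      where open Oᴴ.Cross (config-reverse k) (swap xy) (swap xz) (swap yv)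

    -- Suppose w dominates y. Unless v directly precedes w, `crossing` already gives the arc from x
    -- to v. If it does, then either z comes later, and v and z being apart forces the arc from x to
    -- v, or z comes earlier, and `triple` carries the arc from w to y over to z.
    one-way-at : ∀ {z w v} → z ∈ ps → w ∈ ps → v ∈ ps → z ≢ w →
      NonAdj x z → NonAdj x w → NonAdj y v → Arc D y w ⊎ Arc D w y → Arc D x v ⊎ Arc D v x →
      ¬ Arc D z y → ¬ Arc D x v → ¬ Arc D w y
    one-way-at {z} {w} {v} z∈ w∈ v∈ z≢w xz xw yv yw xv ¬zy ¬xv wy with crossing w∈ v∈ xw yv yw xv
    ... | apart wy⇒xv _ _ _ _ = ¬xv (wy⇒xv wy)
    ... | before _ _ _ xv′ _ _ = ¬xv xv′
    ... | behind as bs refl _ _ _ with ∈-++⁻ as z∈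
    ...   | inj₂ (here refl) = Sum.[ proj₁ xz , proj₂ xz ] xv
    ...   | inj₂ (there (here z≡w)) = z≢w z≡w
    ...   | inj₂ (there (there z∈bs)) with ∈-∃++ z∈bs
    ...     | bs′ , cs , refl = ¬xv (vz⇒xv as w bs′ refl xz yv xv)
    one-way-at {z} {w} {v} z∈ w∈ v∈ z≢w xz xw yv yw xv ¬zy ¬xv wy | behind as bs refl _ _ _ | inj₁ z∈as
      with ∈-∃++ z∈as
    ... | as′ , as″ , refl with separate as′ (as″ ++ [ v ]) (subst (Circuit x y) regroup c) xy xz xw
      where
      regroup : (as′ ++ z ∷ as″) ++ v ∷ w ∷ bs ≡ as′ ++ z ∷ (as″ ++ [ v ]) ++ w ∷ bs
      regroup = trans (++-assoc as′ _ _) (cong (λ ys → as′ ++ z ∷ ys) (sym (++-assoc as″ _ _)))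
    ...   | _ , _ , _ , k = ¬zy (triple (rotate (rotate k)) xw xy xz wy)

    -- z has a single predecessor, so one of v and v′ does not directly precede it; that one is used
    -- in `one-way-at`.
    one-way : ∀ {z w v v′} → z ∈ ps → w ∈ ps → v ∈ ps → v′ ∈ ps → z ≢ w → v ≢ v′ →
      NonAdj x z → NonAdj x w → NonAdj y v → NonAdj y v′ →
      Arc D y z ⊎ Arc D z y → Arc D y w ⊎ Arc D w y → Arc D x v ⊎ Arc D v x → Arc D x v′ ⊎ Arc D v′ x →
      ¬ Arc D z y → ¬ Arc D w y
    one-way {z} {w} {v} {v′} z∈ w∈ v∈ v′∈ z≢w v≢v′ xz xw yv yv′ yz yw xv xv′ ¬zy
      with crossing z∈ v∈ xz yv yz xv | crossing z∈ v′∈ xz yv′ yz xv′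
    ... | before _ _ _ _ zy _ | _ = contradiction zy ¬zy
    ... | apart _ xv⇒zy _ _ _ | _ = one-way-at z∈ w∈ v∈ z≢w xz xw yv yw xv ¬zy (¬zy ∘ xv⇒zy)
    ... | behind _ _ _ _ _ _ | before _ _ _ _ zy _ = contradiction zy ¬zy
    ... | behind _ _ _ _ _ _ | apart _ xv⇒zy _ _ _ = one-way-at z∈ w∈ v′∈ z≢w xz xw yv′ yw xv′ ¬zy (¬zy ∘ xv⇒zy)
    ... | behind as _ eq _ _ _ | behind as′ _ eq′ _ _ _ =
          contradiction (previous-unique as as′ (interior-unique c) eq eq′) v≢v′

    -- v can neither directly follow both z and w nor directly precede both. So one of them is apart
    -- from v, which gives both arcs, or the two consecutive positions give one arc each.
    both-ways : ∀ {z w v} → z ∈ ps → w ∈ ps → v ∈ ps → z ≢ w →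
      NonAdj x z → NonAdj x w → NonAdj y v →
      Arc D y z → Arc D z y → Arc D y w → Arc D w y → Arc D x v ⊎ Arc D v x → Arc D x v × Arc D v x
    both-ways z∈ w∈ v∈ z≢w xz xw yv yz zy yw wy xv
      with crossing z∈ v∈ xz yv (inj₁ yz) xv | crossing w∈ v∈ xw yv (inj₁ yw) xv
    ... | apart zy⇒xv _ yz⇒vx _ _ | _ = zy⇒xv zy , yz⇒vx yz
    ... | _ | apart wy⇒xv _ yw⇒vx _ _ = wy⇒xv wy , yw⇒vx yw
    ... | before _ _ _ xv′ _ _ | behind _ _ _ vx′ _ _ = xv′ , vx′
    ... | behind _ _ _ vx′ _ _ | before _ _ _ xv′ _ _ = xv′ , vx′
    ... | before as _ eq _ _ _ | before as′ _ eq′ _ _ _ =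
          contradiction (previous-unique as as′ (interior-unique c) eq eq′) z≢w
    ... | behind as _ eq _ _ _ | behind as′ _ eq′ _ _ _ =
          contradiction (next-unique {as = as} {as′} (interior-unique c) eq eq′) z≢w

    cross-adjacent : ∀ {z v} → z ∈ ps → v ∈ ps → NonAdj x z → NonAdj y v →
      Arc D y z ⊎ Arc D z y → Arc D x v → Arc D v x → Arc D z v ⊎ Arc D v z
    cross-adjacent z∈ v∈ xz yv yz xv vx with crossing z∈ v∈ xz yv yz (inj₁ xv)
    ... | apart _ _ _ _ adj = adj xv vx
    ... | before _ _ _ _ _ zv = inj₁ zv
    ... | behind _ _ _ _ _ vz = inj₂ vz

-- Counting

⟦_⟧ᵇ : Bool → ℕ
⟦ b ⟧ᵇ = if b then 1 else 0

bool≤1 : ∀ b → ⟦ b ⟧ᵇ ≤ 1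
bool≤1 true = ≤-refl
bool≤1 false = z≤n

∧-intro : ∀ {a b} → a ≡ true → b ≡ true → a ∧ b ≡ true
∧-intro refl refl = refl

∧-elim : ∀ a {b} → a ∧ b ≡ true → a ≡ true × b ≡ true
∧-elim true p = refl , p

module _ {A : Set} where

  countB-↭ : ∀ (p : A → Bool) {xs ys} → xs ↭ ys → countB p xs ≡ countB p ys
  countB-↭ p σ = sum-↭ (map⁺ (λ a → ⟦ p a ⟧ᵇ) σ)

  countB≤ : ∀ p {v : A} {xs} → v ∈ xs → p v ≡ true → 1 ≤ countB p xs
  countB≤ p (here refl) pv rewrite pv = s≤s z≤n
  countB≤ p {xs = x ∷ xs} (there v∈) pv = ≤-trans (countB≤ p v∈ pv) (m≤n+m _ ⟦ p x ⟧ᵇ)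

  2≤countB : ∀ p {u v : A} {xs} → u ∈ xs → v ∈ xs → u ≢ v → p u ≡ true → p v ≡ true → 2 ≤ countB p xs
  2≤countB p (here refl) (here refl) u≢v pu pv = contradiction refl u≢v
  2≤countB p (here refl) (there v∈) u≢v pu pv rewrite pu = s≤s (countB≤ p v∈ pv)
  2≤countB p (there u∈) (here refl) u≢v pu pv rewrite pv = s≤s (countB≤ p u∈ pu)
  2≤countB p {xs = x ∷ xs} (there u∈) (there v∈) u≢v pu pv =
    ≤-trans (2≤countB p u∈ v∈ u≢v pu pv) (m≤n+m _ ⟦ p x ⟧ᵇ)

  countB-witness : ∀ p (xs : List A) → 1 ≤ countB p xs → ∃ λ u → u ∈ xs × p u ≡ true
  countB-witness p (x ∷ xs) h with p x in eq
  ... | true = x , here refl , eq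
  ... | false with countB-witness p xs h
  ...   | u , u∈ , pu = u , there u∈ , pu

  countB-witnesses : ∀ p (xs : List A) → Unique xs → 2 ≤ countB p xs →
    ∃ λ u → ∃ λ v → u ∈ xs × v ∈ xs × u ≢ v × p u ≡ true × p v ≡ true
  countB-witnesses p (x ∷ xs) (x∉ ∷ q) h with p x in eq
  ... | true with countB-witness p xs (≤-pred h)
  ...   | v , v∈ , pv = x , v , here refl , there v∈ , All.lookup x∉ v∈ , eq , pv
  countB-witnesses p (x ∷ xs) (x∉ ∷ q) h | false with countB-witnesses p xs q h
  ... | u , v , u∈ , v∈ , u≢v , pu , pv = u , v , there u∈ , there v∈ , u≢v , pu , pv

  countB≤1 : ∀ p (xs : List A) → Unique xs →
    (∀ {u v} → u ∈ xs → v ∈ xs → p u ≡ true → p v ≡ true → u ≡ v) → countB p xs ≤ 1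
  countB≤1 p xs q h = ≮⇒≥ λ 2≤ → case countB-witnesses p xs q 2≤ of λ
    (_ , _ , u∈ , v∈ , u≢v , pu , pv) → u≢v (h u∈ v∈ pu pv)

  countB≡0 : ∀ (p : A → Bool) xs → (∀ v → p v ≡ false) → countB p xs ≡ 0
  countB≡0 p []       h = refl
  countB≡0 p (x ∷ xs) h rewrite h x = countB≡0 p xs h

  sum-map-+ : ∀ (f g : A → ℕ) xs → sum (map (λ a → f a + g a) xs) ≡ sum (map f xs) + sum (map g xs)
  sum-map-+ f g []       = refl
  sum-map-+ f g (x ∷ xs) rewrite sum-map-+ f g xs =
    solve 4 (λ a b c d → (a :+ b) :+ (c :+ d) := (a :+ c) :+ (b :+ d)) refl (f x) (g x) (sum (map f xs)) (sum (map g xs))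
    where open +-*-Solver

  sum-map-mono : ∀ {f g : A → ℕ} → (∀ a → f a ≤ g a) → ∀ xs → sum (map f xs) ≤ sum (map g xs)
  sum-map-mono h []       = z≤n
  sum-map-mono h (x ∷ xs) = +-mono-≤ (h x) (sum-map-mono h xs)

  sum-map-0 : ∀ (xs : List A) → sum (map (λ _ → 0) xs) ≡ 0
  sum-map-0 []       = refl
  sum-map-0 (x ∷ xs) = sum-map-0 xs

module _ {A B : Set} where

  -- The true entries of `M` are counted once by rows and once by columns.
  double-count : ∀ (P : A → Bool) (Q : B → Bool) (M : A → B → Bool) xs ys →
    (∀ {t} → t ∈ xs → P t ≡ true → 2 ≤ countB (M t) ys) →
    (∀ v → countB (λ t → M t v) xs ≤ ⟦ Q v ⟧ᵇ) →
    countB P xs + countB P xs ≤ countB Q ys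
  double-count P Q M xs ys rows columns =
    ≤-trans (by-rows xs rows) (≤-trans (≤-reflexive (exchange-sums xs)) (sum-map-mono columns ys))
    where
    exchange-sums : ∀ xs → sum (map (λ t → countB (M t) ys) xs) ≡ sum (map (λ v → countB (λ t → M t v) xs) ys)
    exchange-sums []       = sym (sum-map-0 ys)
    exchange-sums (t ∷ xs) rewrite exchange-sums xs =
      sym (sum-map-+ (λ v → ⟦ M t v ⟧ᵇ) (λ v → countB (λ t → M t v) xs) ys)
    by-rows : ∀ xs → (∀ {t} → t ∈ xs → P t ≡ true → 2 ≤ countB (M t) ys) →
              countB P xs + countB P xs ≤ sum (map (λ t → countB (M t) ys) xs)
    by-rows []       h = z≤n
    by-rows (t ∷ xs) h with P t in eq
    ... | false = ≤-trans (by-rows xs (h ∘ there)) (m≤n+m _ _)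
    ... | true  = ≤-trans (≤-reflexive (cong suc (+-suc _ _))) (+-mono-≤ (h (here refl) eq) (by-rows xs (h ∘ there)))

module _ {n} (D : Digraph n) where

  open Segments D

  nonAdjB : V → V → Bool
  nonAdjB u v = not (adjB D u v)

  bothB : V → V → Bool
  bothB u v = arc D u v ∧ arc D v u

  nonAdjB⇒NonAdj : ∀ u v → nonAdjB u v ≡ true → NonAdj u v
  nonAdjB⇒NonAdj u v p with arc D u v | arc D v u
  ... | false | false = (λ ()) , (λ ())

  NonAdj⇒nonAdjB : ∀ u v → NonAdj u v → nonAdjB u v ≡ true
  NonAdj⇒nonAdjB u v (p , q) with arc D u v | arc D v u
  ... | true  | _     = contradiction refl p
  ... | false | true  = contradiction refl q
  ... | false | false = refl

  NonAdj? : ∀ u v → Dec (NonAdj u v)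
  NonAdj? u v with nonAdjB u v Bool.≟ true
  ... | yes p = yes (nonAdjB⇒NonAdj u v p)
  ... | no ¬p = no (¬p ∘ NonAdj⇒nonAdjB u v)

  adjacent : ∀ {u v} → ¬ NonAdj u v → Arc D u v ⊎ Arc D v u
  adjacent {u} {v} ¬p with arc D u v | arc D v u
  ... | true  | _     = inj₁ refl
  ... | false | true  = inj₂ refl
  ... | false | false = contradiction ((λ ()) , (λ ())) ¬p

-- Pairwise adjacent non-neighbours

module Clique {n} (D : Digraph n) (R : Segments.Rigid D)
  (two : ∀ {x y ps} → Walks.Circuit D x y ps →
         ∃ λ u → ∃ λ v → u ∈ ps × v ∈ ps × u ≢ v × Segments.NonAdj D x u × Segments.NonAdj D x v) where

  open Segments D
  open Walks D
  open Rules R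
  open Structure D R
  private
    R° = rigid-reverse D R
    module S° = Structure (D ᵒ) R°

  relocate : ∀ {x y ps t} → Circuit x y ps → t ≢ x → ∃ λ qs → Circuit x t qs
  relocate {x} {y} {ps} {t} c t≢x with t ≟ y
  ... | yes refl = ps , c
  ... | no t≢y with ∈-∃++ (on-circuit c t≢x t≢y)
  ...   | as , bs , refl = bs ++ y ∷ as , rebase as c

  Free : V → V → Set
  Free x t = t ≢ x × NonAdj x t

  module _ {x} (circuit-at : ∀ {t} → t ≢ x → ∃ λ qs → Circuit x t qs)
           (clique : ∀ {u v} → Free x u → Free x v → u ≢ v → Arc D u v ⊎ Arc D v u) where

    -- Were v a non-neighbour of x as well, `clique` would join it to y.
    meets : ∀ {y v ps} → Circuit x y ps → Free x y → v ∈ ps → NonAdj y v → Arc D x v ⊎ Arc D v x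
    meets c fy v∈ yv = adjacent D λ xv →
      Sum.[ proj₁ yv , proj₂ yv ] (clique fy (off≢interior c v∈ , xv) (base≢interior c v∈ ∘ sym))

    -- `two`, applied to the circuit missing y, supplies the two non-neighbours of y that `one-way`
    -- needs.
    no-in : ∀ {y z w} → Free x y → Free x z → Free x w → z ≢ y → w ≢ y → z ≢ w → ¬ Arc D z y → ¬ Arc D w y
    no-in {y} {z} {w} fy fz fw z≢y w≢y z≢w with circuit-at (proj₁ fy)
    ... | ps , c with two (exchange c (proj₂ fy))
    ...   | v , v′ , v∈ , v′∈ , v≢v′ , yv , yv′ =
      Crosses.one-way c (proj₂ fy) (on-circuit c (proj₁ fz) z≢y) (on-circuit c (proj₁ fw) w≢y) v∈ v′∈ z≢w v≢v′
        (proj₂ fz) (proj₂ fw) yv yv′ (clique fy fz (z≢y ∘ sym)) (clique fy fw (w≢y ∘ sym))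
        (meets c fy v∈ yv) (meets c fy v′∈ yv′)

    no-out : ∀ {y z w} → Free x y → Free x z → Free x w → z ≢ y → w ≢ y → z ≢ w → ¬ Arc D y z → ¬ Arc D y w
    no-out {y} {z} {w} fy fz fw z≢y w≢y z≢w with circuit-at (proj₁ fy)
    ... | ps , c with two (exchange c (proj₂ fy))
    ...   | v , v′ , v∈ , v′∈ , v≢v′ , yv , yv′ =
      S°.Crosses.one-way (circuit-reverse D c) (swap (proj₂ fy))
        (rev (on-circuit c (proj₁ fz) z≢y)) (rev (on-circuit c (proj₁ fw) w≢y)) (rev v∈) (rev v′∈) z≢w v≢v′
        (swap (proj₂ fz)) (swap (proj₂ fw)) (swap yv) (swap yv′) (clique fz fy z≢y) (clique fw fy w≢y)
        (Sum.swap (meets c fy v∈ yv)) (Sum.swap (meets c fy v′∈ yv′))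
      where
      rev : ∀ {u} → u ∈ ps → u ∈ reverse ps
      rev = ∈-resp-↭ (↭-sym (↭-reverse ps))

    third : ∀ {y} z → Free x y → ∃ λ w → Free x w × w ≢ y × w ≢ z
    third z fy with circuit-at (proj₁ fy)
    ... | ps , c with two c
    ...   | u , v , u∈ , v∈ , u≢v , xu , xv with u ≟ z
    ...     | no u≢z = u , (off≢interior c u∈ , xu) , base≢interior c u∈ , u≢z
    ...     | yes refl = v , (off≢interior c v∈ , xv) , base≢interior c v∈ , u≢v ∘ sym

    -- A missing arc from z to y spreads: with a third free vertex w, `no-in` and `no-out` remove
    -- both arcs between z and w, against `clique`.
    complete : ∀ {y z} → Free x y → Free x z → z ≢ y → Arc D z y
    complete {y} {z} fy fz z≢y with third z fy
    ... | w , fw , w≢y , w≢z = decidable-stable (Arc? z y) λ ¬zy →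
      let ¬wy = no-in fy fz fw z≢y w≢y (w≢z ∘ sym) ¬zy
          ¬zw = no-out fz fy fw (z≢y ∘ sym) w≢z (w≢y ∘ sym) ¬zy
          ¬wz = no-out fw fy fz (w≢y ∘ sym) (w≢z ∘ sym) (z≢y ∘ sym) ¬wy
      in Sum.[ ¬zw , ¬wz ] (clique fz fw (w≢z ∘ sym))

    -- Two further free vertices z and w are joined to y both ways by `complete`, as `both-ways`
    -- requires.
    both : ∀ {y v ps} → Circuit x y ps → Free x y → v ∈ ps → NonAdj y v → Arc D x v × Arc D v x
    both {y} c fy v∈ yv with third y fy
    ... | z , fz , z≢y , _ with third z fy
    ...   | w , fw , w≢y , w≢z = Crosses.both-ways c (proj₂ fy)
      (on-circuit c (proj₁ fz) z≢y) (on-circuit c (proj₁ fw) w≢y) v∈ (w≢z ∘ sym) (proj₂ fz) (proj₂ fw) yv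
      (complete fz fy (z≢y ∘ sym)) (complete fy fz z≢y) (complete fw fy (w≢y ∘ sym)) (complete fy fw w≢y)
      (meets c fy v∈ yv)

    -- Each free vertex misses at least two vertices joined to x both ways, and distinct free vertices miss distinct ones.
    too-many : ∀ {y ps} → Circuit x y ps →
      3 ≤ countB (nonAdjB D x) (y ∷ ps) → countB (bothB D x) (allFin n) ≤ countB (nonAdjB D x) (y ∷ ps) → ⊥
    -- Double counting finds at least `k + k` vertices joined to x both ways, but `few` allows at
    -- most `k`, and `k` is positive.
    too-many {y} {ps} c 3≤ few = <⇒≱ (m<n+m k (≤-trans (s≤s z≤n) 3≤)) (≤-trans
      (double-count P Q (λ t v → P t ∧ nonAdjB D t v ∧ Q v) (y ∷ ps) (allFin n) rows columns) few)
      where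
      P = nonAdjB D x
      Q = bothB D x
      k = countB P (y ∷ ps)
      free : ∀ {t} → t ∈ y ∷ ps → P t ≡ true → Free x t
      free t∈ p = (λ { refl → off t∈ }) , nonAdjB⇒NonAdj D x _ p
        where
        off : ¬ x ∈ y ∷ ps
        off (here x≡y) = off≢base c x≡y
        off (there x∈) = off≢interior c x∈ refl
      rows : ∀ {t} → t ∈ y ∷ ps → P t ≡ true → 2 ≤ countB (λ v → P t ∧ nonAdjB D t v ∧ Q v) (allFin n)
      rows {t} t∈ p with circuit-at (proj₁ (free t∈ p))
      ... | qs , c′ with two (exchange c′ (proj₂ (free t∈ p)))
      ...   | v , v′ , v∈ , v′∈ , v≢v′ , tv , tv′ = 2≤countB _ (∈-allFin v) (∈-allFin v′) v≢v′ (hit v∈ tv) (hit v′∈ tv′)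
        where
        hit : ∀ {v} → v ∈ qs → NonAdj t v → P t ∧ nonAdjB D t v ∧ Q v ≡ true
        hit v∈ tv = ∧-intro p (∧-intro (NonAdj⇒nonAdjB D t _ tv)
          (∧-intro (proj₁ (both c′ (free t∈ p) v∈ tv)) (proj₂ (both c′ (free t∈ p) v∈ tv))))
      columns : ∀ v → countB (λ t → P t ∧ nonAdjB D t v ∧ Q v) (y ∷ ps) ≤ ⟦ Q v ⟧ᵇ
      columns v with Q v in eq
      ... | false = ≤-reflexive (countB≡0 _ (y ∷ ps) λ t → trans (cong (P t ∧_) (Bool.∧-zeroʳ (nonAdjB D t v))) (Bool.∧-zeroʳ (P t)))
      ... | true = countB≤1 _ (y ∷ ps) unique disjoint
        where
        unique : Unique (y ∷ ps)
        unique with circuit-unique c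
        ... | _ ∷ q = q
        xv = ∧-elim (arc D x v) eq
        disjoint : ∀ {t u} → t ∈ y ∷ ps → u ∈ y ∷ ps → P t ∧ nonAdjB D t v ∧ true ≡ true →
                   P u ∧ nonAdjB D u v ∧ true ≡ true → t ≡ u
        disjoint {t} {u} t∈ u∈ pt pu with t ≟ u | ∧-elim (P t) pt | ∧-elim (P u) pu
        ... | yes t≡u | _ | _ = t≡u
        ... | no t≢u | Pt , qt | Pu , qu with free t∈ Pt | free u∈ Pu | nonAdjB⇒NonAdj D t v (proj₁ (∧-elim (nonAdjB D t v) qt)) | nonAdjB⇒NonAdj D u v (proj₁ (∧-elim (nonAdjB D u v) qu))
        ...   | ft | fu | tv | uv with circuit-at (proj₁ ft)
        -- A vertex v that is joined to x both ways and missed by t is adjacent to every other free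
        -- vertex.
        ...     | qs , c′ = ⊥-elim (Sum.[ proj₁ uv , proj₂ uv ] (Crosses.cross-adjacent c′ (proj₂ ft)
                  (on-circuit c′ (proj₁ fu) (t≢u ∘ sym)) (on-circuit c′ v≢x v≢t) (proj₂ fu) tv
                  (clique ft fu t≢u) (proj₁ xv) (proj₂ xv)))
          where
          v≢x : v ≢ x
          v≢x refl = no-loop (proj₁ xv)
          v≢t : v ≢ t
          v≢t refl = proj₁ (proj₂ ft) (proj₁ xv)

-- Degree bounds for the missing vertex

bool-ext : ∀ {a b} → (a ≡ true → b ≡ true) → (b ≡ true → a ≡ true) → a ≡ b
bool-ext {true}          f g = sym (f refl)
bool-ext {false} {false} f g = refl
bool-ext {false} {true}  f g = g refl

at-most-one : ∀ {a b} → ¬ (a ≡ true × b ≡ true) → ⟦ a ⟧ᵇ + ⟦ b ⟧ᵇ ≤ 1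
at-most-one {true}  {true}  h = contradiction (refl , refl) h
at-most-one {true}  {false} h = ≤-refl
at-most-one {false} {b}     h = bool≤1 b

walk⇒closed : ∀ {n} (D : Digraph n) {u xs v} → Walks.Walk D u xs v →
  Σ (Fin n) λ b → Segments.Seg D u (u ∷ xs) b × Arc D b v
walk⇒closed D (Walks.step r) = _ , Segments.one , r
walk⇒closed D (r Walks.∷ p) with walk⇒closed D p
... | b , s , t = b , Segments.cons r s , t

module Degrees {n} (D : Digraph n) (x : Fin n) where

  open Segments D

  ins outs nons boths : List V → ℕ
  ins   = countB (λ v → arc D v x)
  outs  = countB (arc D x)
  nons  = countB (nonAdjB D x)
  boths = countB (bothB D x)

  NotInsertable : V → List V → V → Set
  NotInsertable a xs b = ∀ {u v pre suf} → Seg a pre u → Arc D u v → Seg v suf b → xs ≡ pre ++ suf →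
                         ¬ (Arc D u x × Arc D x v)

  -- Each arc from u to v on the path allows at most one of the arcs from u to x and from x to v.
  -- These pairs account for all arcs between x and the path, except those from x to `a` and from
  -- `b` to x.
  insertion-bound : ∀ {a xs b} → Seg a xs b → NotInsertable a xs b →
    suc (ins xs + outs xs) ≤ length xs + (⟦ arc D x a ⟧ᵇ + ⟦ arc D b x ⟧ᵇ)
  insertion-bound (one {v}) h = ≤-reflexive (cong suc (solve 2 (λ i o → (i :+ con 0) :+ (o :+ con 0) := o :+ i) refl ⟦ arc D v x ⟧ᵇ ⟦ arc D x v ⟧ᵇ))
    where open +-*-Solver
  insertion-bound {b = b} (cons {u} {v} {xs} r s) h = begin
    suc ((ux + ins xs) + (xu + outs xs))          ≡⟨ solve 4 (λ a b c d → con 1 :+ ((a :+ b) :+ (c :+ d)) := (a :+ c) :+ (con 1 :+ (b :+ d))) refl ux (ins xs) xu (outs xs) ⟩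
    (ux + xu) + suc (ins xs + outs xs)            ≤⟨ +-monoʳ-≤ (ux + xu) (insertion-bound s λ t r′ t′ eq → h (cons r t) r′ t′ (cong (u ∷_) eq)) ⟩
    (ux + xu) + (length xs + (xv + bx))           ≡⟨ solve 5 (λ a b c d e → (a :+ b) :+ (c :+ (d :+ e)) := (a :+ d) :+ (c :+ (b :+ e))) refl ux xu (length xs) xv bx ⟩
    (ux + xv) + (length xs + (xu + bx))           ≤⟨ +-monoˡ-≤ _ (at-most-one (h one r s refl)) ⟩
    suc (length xs + (xu + bx))                   ∎
    where
    open ≤-Reasoning
    open +-*-Solver using (solve; _:+_; _:=_; con)
    ux = ⟦ arc D u x ⟧ᵇ
    xu = ⟦ arc D x u ⟧ᵇ
    xv = ⟦ arc D x v ⟧ᵇ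
    bx = ⟦ arc D b x ⟧ᵇ

  inclusion–exclusion : ∀ xs → (ins xs + outs xs) + nons xs ≡ length xs + boths xs
  inclusion–exclusion []       = refl
  inclusion–exclusion (v ∷ xs) with arc D v x | arc D x v
  ... | true  | true  = trans (solve 3 (λ a b c → ((con 1 :+ a) :+ (con 1 :+ b)) :+ c := con 2 :+ ((a :+ b) :+ c)) refl (ins xs) (outs xs) (nons xs))
                          (trans (cong (λ k → suc (suc k)) (inclusion–exclusion xs)) (cong suc (sym (+-suc _ _))))
    where open +-*-Solver
  ... | true  | false = cong suc (inclusion–exclusion xs)
  ... | false | true  = trans (cong (_+ nons xs) (+-suc (ins xs) (outs xs))) (cong suc (inclusion–exclusion xs))
  ... | false | false = trans (+-suc _ _) (cong suc (inclusion–exclusion xs))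

  module _ {xs} (σ : x ∷ xs ↭ allFin n) where

    suc-length : suc (length xs) ≡ n
    suc-length = trans (↭-length σ) (length-tabulate (λ i → i))

    countB-off : ∀ p → p x ≡ false → countB p (allFin n) ≡ countB p xs
    countB-off p px = trans (sym (countB-↭ p σ)) (cong (λ t → ⟦ t ⟧ᵇ + countB p xs) px)

-- Twins when every missing vertex has large semidegrees and three non-neighbours

module Good {m : ℕ} (D : Digraph (2 * m + 1))
  (no-ham : ∀ X → Segments._⟶_ D X X → ¬ (Segments.verts {D = D} X ↭ allFin (2 * m + 1)))
  (good : ∀ {x} X → Segments._⟶_ D X X → x ∷ Segments.verts {D = D} X ↭ allFin (2 * m + 1) →
          m ≤ indeg D x × m ≤ outdeg D x × 3 ≤ countB (nonAdjB D x) (Segments.verts {D = D} X)) where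

  open Segments D
  open Walks D

  private
    n = 2 * m + 1

  not-insertable : ∀ {x} (X : Piece) → X ⟶ X → x ∷ verts X ↭ allFin n →
                   Degrees.NotInsertable D x (first X) (verts X) (last X)
  not-insertable {x} X r σ {pre = pre} {suf} s t s′ eq (ux , xv) = no-ham
    (pt x ▸⟨ xv ⟩ piece s′ ▸⟨ r ⟩ piece s) ux
    (↭-trans (↭-prep x (↭-trans (++-comm suf pre) (↭-reflexive (sym eq)))) σ)

  not-closing : ∀ {x} (X : Piece) → X ⟶ X → x ∷ verts X ↭ allFin n → ¬ (Arc D x (first X) × Arc D (last X) x)
  not-closing {x} X r σ (xa , bx) = no-ham (pt x ▸⟨ xa ⟩ X) bx σ

  rigid : Rigid
  rigid = record { no-ham = no-ham ; gap = gap }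
    where
    gap : ∀ {x} X → X ⟶ X → x ∷ verts X ↭ allFin n → ¬ Arc D (last X) x → Arc D x (first X)
    gap {x} X r σ ¬bx = decidable-stable (Arc? _ _) λ ¬xa → case good X r σ of λ (in≥ , out≥ , _) →
      -- The semidegrees add up to at least 2m, but with both end arcs absent a path on 2m vertices
      -- permits at most 2m - 1.
      1+n≰n (begin
        suc (m + m)                             ≤⟨ s≤s (+-mono-≤ (subst (m ≤_) (countB-off σ _ (loopless D x)) in≥)
                                                                 (subst (m ≤_) (countB-off σ _ (loopless D x)) out≥)) ⟩
        suc (ins (verts X) + outs (verts X))    ≤⟨ insertion-bound (seg X) (not-insertable X r σ) ⟩
        length (verts X) + (⟦ arc D x (first X) ⟧ᵇ + ⟦ arc D (last X) x ⟧ᵇ)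
          ≡⟨ cong (length (verts X) +_) (cong₂ (λ a b → ⟦ a ⟧ᵇ + ⟦ b ⟧ᵇ) (Bool.¬-not ¬xa) (Bool.¬-not ¬bx)) ⟩
        length (verts X) + 0                    ≡⟨ +-identityʳ _ ⟩
        length (verts X)                        ≡⟨ suc-injective (trans (suc-length σ) (trans (+-comm (2 * m) 1) (cong suc (cong (m +_) (+-identityʳ m))))) ⟩
        m + m                                   ∎)
      where
      open Degrees D x
      open ≤-Reasoning

  -- x cannot be inserted anywhere on the cycle, so its semidegrees add up to at most the length of
  -- the cycle; `inclusion–exclusion` turns this into the comparison.
  both≤nonAdj : ∀ {x} (X : Piece) → X ⟶ X → x ∷ verts X ↭ allFin n →
                countB (bothB D x) (allFin n) ≤ countB (nonAdjB D x) (verts X)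
  both≤nonAdj {x} X r σ = begin
    boths (allFin n)     ≡⟨ countB-off σ _ (cong (_∧ arc D x x) (loopless D x)) ⟩
    boths (verts X)      ≤⟨ +-cancelˡ-≤ (length (verts X)) _ _ (begin
      length (verts X) + boths (verts X)                     ≡⟨ inclusion–exclusion (verts X) ⟨
      (ins (verts X) + outs (verts X)) + nons (verts X)      ≤⟨ +-monoˡ-≤ _ in+out≤ ⟩
      length (verts X) + nons (verts X)                      ∎) ⟩
    nons (verts X)       ∎
    where
    open Degrees D x
    open ≤-Reasoning
    in+out≤ : ins (verts X) + outs (verts X) ≤ length (verts X)
    in+out≤ = ≤-pred (≤-trans (insertion-bound (seg X) (not-insertable X r σ))
      (≤-trans (+-monoʳ-≤ _ (at-most-one (not-closing X r σ))) (≤-reflexive (+-comm _ 1))))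

  open Rules rigid
  open Structure D rigid

  no-ham-walk : ∀ {y ps} → Walk y ps y → ¬ (y ∷ ps ↭ allFin n)
  no-ham-walk p with walk⇒closed D p
  ... | _ , s , r = no-ham (piece s) r

  many : ∀ {x y ps} → Circuit x y ps →
         3 ≤ countB (nonAdjB D x) (y ∷ ps) × countB (bothB D x) (allFin n) ≤ countB (nonAdjB D x) (y ∷ ps)
  many (circuit p σ) with walk⇒closed D p
  ... | _ , s , r = proj₂ (proj₂ (good (piece s) r σ)) , both≤nonAdj (piece s) r σ

  two : ∀ {x y ps} → Circuit x y ps → ∃ λ u → ∃ λ v → u ∈ ps × v ∈ ps × u ≢ v × NonAdj x u × NonAdj x v
  -- The base y is not in `ps`, so one of the three non-neighbours may be lost.
  two {x} {y} {ps} c with countB-witnesses (nonAdjB D x) ps (interior-unique c)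
      (≤-pred (≤-trans (proj₁ (many c)) (+-monoˡ-≤ _ (bool≤1 (nonAdjB D x y)))))
  ... | u , v , u∈ , v∈ , u≢v , xu , xv = u , v , u∈ , v∈ , u≢v , nonAdjB⇒NonAdj D x u xu , nonAdjB⇒NonAdj D x v xv

  open Clique D rigid two

  -- Without such a z, the non-neighbours of x would be pairwise adjacent: two non-adjacent ones
  -- other than y would be non-adjacent to y by `nonAdj-trans`. This is the case excluded by
  -- `too-many`.
  partner : ∀ {x y ps} → Circuit x y ps → NonAdj x y → ∃ λ z → z ∈ ps × NonAdj x z × NonAdj y z
  partner {x} {y} {ps} c xy with any? (λ z → NonAdj? D x z ×-dec NonAdj? D y z) ps
  ... | yes p with find p
  ...   | z , z∈ , xz , yz = z , z∈ , xz , yz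
  partner {x} {y} {ps} c xy | no ¬p = ⊥-elim (too-many (relocate c) clique c (proj₁ (many c)) (proj₂ (many c)))
    where
    alone : ∀ {v} → v ∈ ps → NonAdj x v → ¬ NonAdj y v
    alone v∈ xv yv = ¬p (lose v∈ (xv , yv))
    clique : ∀ {u v} → Free x u → Free x v → u ≢ v → Arc D u v ⊎ Arc D v u
    clique {u} {v} (u≢x , xu) (v≢x , xv) u≢v = adjacent D λ uv → case ((u ≟ y) , (v ≟ y)) of λ where
      (yes refl , _)       → alone (on-circuit c v≢x (u≢v ∘ sym)) xv uv
      (no u≢y , yes refl)  → alone (on-circuit c u≢x u≢y) xu (swap uv)
      (no u≢y , no v≢y)    → case relocate c u≢x of λ (_ , c′) →
        alone (on-circuit c u≢x u≢y) xu (swap (nonAdj-trans c′ (on-circuit c′ (off≢base c ∘ sym) (u≢y ∘ sym))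
          (on-circuit c′ v≢x (u≢v ∘ sym)) (v≢y ∘ sym) xu xy xv uv))

  module _ {z : V} where

    -- Here x, y and z can replace each other; the Hamiltonian cycle uses u → y and x → v and closes the rest with z.
    no-detour : ∀ {x y u v} as {bs} → Circuit x y (as ++ u ∷ v ∷ bs) → z ∈ as ++ u ∷ v ∷ bs →
                NonAdj x y → NonAdj x z → NonAdj y z → Arc D u y → ¬ Arc D x v
    no-detour {x} {y} {u} {v} as {bs} c z∈ xy xz yz uy xv with ∈-++⁻ as z∈
    ... | inj₂ (here refl) = proj₂ yz uy
    ... | inj₂ (there (here refl)) = proj₁ xz xv
    ... | inj₁ z∈as with ∈-∃++ z∈as
    ...   | as₁ , as₂ , refl = no-ham-walk
      (walk-++ y-to-x (xv ∷ walk-++ v-to-z (walk-++ z-to-u (step uy))))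
      (↭-trans (reorder (𝕪 ⊕ 𝔸 ⊕ 𝕩 ⊕ ℂ ⊕ 𝕫 ⊕ 𝔹 ⊕ 𝕨)
        (as₁ ∷ as₂ ∷ (v ∷ bs) ∷ [ x ] ∷ [ y ] ∷ [ z ] ∷ [ u ] ∷ [])) (Circuit.all c′))
      where
      c′ : Circuit x y (as₁ ++ z ∷ as₂ ++ u ∷ v ∷ bs)
      c′ = subst (Circuit x y) (++-assoc as₁ (z ∷ as₂) (u ∷ v ∷ bs)) c
      rest = as₂ ++ u ∷ v ∷ bs
      cz : Circuit z x (rest ++ y ∷ as₁)
      cz = exchange (rebase as₁ c′) xz
      cy : Circuit y z (as₁ ++ x ∷ rest)
      cy = exchange (rebase rest cz) (swap yz)
      y-to-x = proj₂ (walk-split rest (Circuit.walk cz))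
      z-to-u = proj₁ (walk-split as₂ (proj₂ (walk-split as₁ (Circuit.walk c′))))
      v-to-z = proj₂ (walk-split [] (proj₂ (walk-split as₂ (proj₂ (walk-split as₁ (Circuit.walk cy))))))
    no-detour {x} {y} {u} {v} as {bs} c z∈ xy xz yz uy xv | inj₂ (there (there z∈bs)) with ∈-∃++ z∈bs
    ...   | bs₁ , bs₂ , refl = no-ham-walk
      (xv ∷ walk-++ v-to-z (walk-++ z-to-u (uy ∷ y-to-x)))
      (↭-trans (reorder (𝕩 ⊕ 𝔹 ⊕ 𝕨 ⊕ 𝔸 ⊕ 𝕫 ⊕ 𝕪 ⊕ ℂ)
        (as ∷ (v ∷ bs₁) ∷ bs₂ ∷ [ x ] ∷ [ y ] ∷ [ u ] ∷ [ z ] ∷ [])) (Circuit.all c))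
      where
      rest = as ++ u ∷ v ∷ bs₁
      c′ : Circuit x y (rest ++ z ∷ bs₂)
      c′ = subst (Circuit x y) (sym (++-assoc as (u ∷ v ∷ bs₁) (z ∷ bs₂))) c
      cz : Circuit z x (bs₂ ++ y ∷ rest)
      cz = exchange (rebase rest c′) xz
      cy : Circuit y z (rest ++ x ∷ bs₂)
      cy = exchange (rebase bs₂ cz) (swap yz)
      cx : Circuit z y (bs₂ ++ x ∷ rest)
      cx = exchange (rebase rest (exchange c′ xy)) yz
      v-to-z = proj₁ (walk-split bs₁ (proj₂ (walk-split [] (proj₂ (walk-split as (Circuit.walk c))))))
      z-to-u = proj₁ (walk-split as (proj₁ (walk-split rest (Circuit.walk cy)) ))
      y-to-x = proj₁ (walk-split bs₂ (Circuit.walk cx))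

    -- If an arc between w and y had no counterpart at x, the dichotomy would join x to the
    -- neighbour of w on the circuit, which is the situation that `no-detour` excludes.
    twins : ∀ {x y ps} → Circuit x y ps → z ∈ ps → NonAdj x y → NonAdj x z → NonAdj y z →
            ∀ w → (Arc D w y → Arc D w x) × (Arc D y w → Arc D x w)
    twins {x} {y} {ps} c z∈ xy xz yz w = incoming , outgoing
      where
      cx : Circuit y x ps
      cx = exchange c xy
      member : Arc D w y ⊎ Arc D y w → w ∈ ps
      member r = on-circuit c (λ { refl → Sum.[ proj₁ xy , proj₂ xy ] r }) (λ { refl → Sum.[ no-loop , no-loop ] r })
      incoming : Arc D w y → Arc D w x
      incoming wy with ∈-∃++ (member (inj₁ wy))
      -- If w is the last vertex before y, the circuit with x in the place of y already contains the
      -- arc from w to x.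
      ... | as , [] , refl with walk-split as (Circuit.walk cx)
      ...   | _ , step wx = wx
      incoming wy | as , v ∷ bs , refl = decidable-stable (Arc? w x) λ ¬wx →
        no-detour as c z∈ xy xz yz wy (after (rebase as c) ¬wx)
      outgoing : Arc D y w → Arc D x w
      outgoing yw with ∈-∃++ (member (inj₂ yw))
      ... | as , bs , refl with initLast as
      ...   | [] = first-arc cx
      ...   | as′ ∷ʳ′ u = decidable-stable (Arc? x w) λ ¬xw →
        let c′ = subst (Circuit x y) (++-assoc as′ [ u ] (w ∷ bs)) c
            z∈′ = subst (z ∈_) (++-assoc as′ [ u ] (w ∷ bs)) z∈
        in ¬xw (after (rebase as′ c′) λ ux → no-detour as′ (exchange c′ xy) z∈′ (swap xy) yz xz ux yw)

  twin-property : ∀ {x y ps} → Circuit x y ps → NonAdj x y →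
    (∀ w → arc D x w ≡ arc D y w) × (∀ w → arc D w x ≡ arc D w y)
  twin-property {x} {y} c xy with partner c xy
  ... | z , z∈ , xz , yz = (λ w → bool-ext (proj₂ (to w)) (proj₂ (from w))) , (λ w → bool-ext (proj₁ (to w)) (proj₁ (from w)))
    where
    from = twins c z∈ xy xz yz
    to = twins (exchange c xy) z∈ (swap xy) yz xz

-- From cycles to circuits

module _ {A : Set} where

  unique-⊆⇒↭ : ∀ {xs ys : List A} → Unique xs → (∀ {v} → v ∈ xs → v ∈ ys) → length ys ≤ length xs → xs ↭ ys
  unique-⊆⇒↭ {[]}     {[]}    _ _ _ = ↭-refl
  unique-⊆⇒↭ {x ∷ xs} (x∉ ∷ q) sub h with ∈-∃++ (sub (here refl))
  ... | as , bs , refl = ↭-trans (↭-prep x (unique-⊆⇒↭ q sub′ (≤-pred (≤-trans (≤-reflexive (sym (↭-length σ))) h)))) (↭-sym σ)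
    where
    σ : as ++ x ∷ bs ↭ x ∷ as ++ bs
    σ = shift x as bs
    sub′ : ∀ {v} → v ∈ xs → v ∈ as ++ bs
    sub′ v∈ with ∈-resp-↭ σ (sub (there v∈))
    ... | here v≡x = contradiction (sym v≡x) (All.lookup x∉ v∈)
    ... | there v∈′ = v∈′

unique-spans : ∀ {n} {xs : List (Fin n)} → Unique xs → length xs ≡ n → xs ↭ allFin n
unique-spans {n} q eq = unique-⊆⇒↭ q (λ _ → ∈-allFin _) (≤-reflexive (trans (length-tabulate (λ i → i)) (sym eq)))

-- Exhaustive search, which takes the place of excluded middle in the final case distinction.
∃Vec? : ∀ {n} k {P : Vec (Fin n) k → Set} → (∀ v → Dec (P v)) → Dec (∃ P)
∃Vec? zero    P? = map′ ([] ,_) (λ { ([] , p) → p }) (P? [])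
∃Vec? (suc k) P? = map′ (λ (x , xs , p) → x ∷ xs , p) (λ { (x ∷ xs , p) → x , xs , p })
                        (Fin.any? λ x → ∃Vec? k λ xs → P? (x ∷ xs))

toℕ-mod : ∀ i {k} → toℕ (i mod suc k) ≡ i % suc k
toℕ-mod i {k} = toℕ-fromℕ< (m%n<n i (suc k))

cnext-mod : ∀ i {k} → cnext (i mod suc k) ≡ suc i mod suc k
cnext-mod i {k} = toℕ-injective (begin
  toℕ (suc (toℕ (i mod suc k)) mod suc k)   ≡⟨ toℕ-mod (suc (toℕ (i mod suc k))) ⟩
  suc (toℕ (i mod suc k)) % suc k           ≡⟨ cong (λ j → suc j % suc k) (toℕ-mod i) ⟩
  suc (i % suc k) % suc k                   ≡⟨ %-distribˡ-+ 1 (i % suc k) (suc k) ⟩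
  (1 % suc k + i % suc k % suc k) % suc k   ≡⟨ cong (λ j → (1 % suc k + j) % suc k) (m%n%n≡m%n i (suc k)) ⟩
  (1 % suc k + i % suc k) % suc k           ≡⟨ %-distribˡ-+ 1 i (suc k) ⟨
  suc i % suc k                             ≡⟨ toℕ-mod (suc i) ⟨
  toℕ (suc i mod suc k)                     ∎)
  where open ≡-Reasoning

toℕ-mod-id : ∀ {k} (i : Fin (suc k)) → toℕ i mod suc k ≡ i
toℕ-mod-id i = toℕ-injective (trans (toℕ-mod (toℕ i)) (m<n⇒m%n≡m (toℕ<n i)))

module FromCycle {n k} (D : Digraph n) (C : Cycle D (suc k)) where

  open Segments D
  open Walks D

  -- Positions are natural numbers read modulo the length, so that a range can run past the end of
  -- the cycle.
  at : ℕ → V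
  at i = cyc C (i mod suc k)

  at-step : ∀ i → Arc D (at i) (at (suc i))
  at-step i = subst (λ j → Arc D (at i) (cyc C j)) (cnext-mod i) (Cycle.steps C (i mod suc k))

  at-period : ∀ i → at (i + suc k) ≡ at i
  at-period i = cong (cyc C) (toℕ-injective (trans (toℕ-mod (i + suc k)) (trans ([m+n]%n≡m%n i (suc k)) (sym (toℕ-mod i)))))

  range : ℕ → ℕ → List V
  range i zero    = []
  range i (suc l) = at i ∷ range (suc i) l

  range-snoc : ∀ i l → range i (suc l) ≡ range i l ++ [ at (i + l) ]
  range-snoc i zero    = cong (λ j → [ at j ]) (sym (+-identityʳ i))
  range-snoc i (suc l) = cong (at i ∷_) (trans (range-snoc (suc i) l) (cong (λ j → range (suc i) l ++ [ at j ]) (sym (+-suc i l))))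

  range-walk : ∀ i l → Walk (at i) (range (suc i) l) (at (i + suc l))
  range-walk i zero    = step (subst (λ j → Arc D (at i) (at j)) (+-comm 1 i) (at-step i))
  range-walk i (suc l) = at-step i ∷ subst (λ j → Walk (at (suc i)) (range (suc (suc i)) l) (at j)) (sym (+-suc i (suc l))) (range-walk (suc i) l)

  range-rotate : ∀ i → range i (suc k) ↭ range 0 (suc k)
  range-rotate zero    = ↭-refl
  range-rotate (suc i) = ↭-trans (↭-trans (↭-reflexive snoc) (↭-sym (∷↭∷ʳ (at i) (range (suc i) k)))) (range-rotate i)
    where
    snoc : range (suc i) (suc k) ≡ range (suc i) k ++ [ at i ]
    snoc = trans (range-snoc (suc i) k) (cong (λ v → range (suc i) k ++ [ v ]) (trans (cong at (sym (+-suc i k))) (at-period i)))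

  at∈range : ∀ {j} i l → i ≤ j → j < i + l → at j ∈ range i l
  at∈range i zero i≤j j< = contradiction (≤-trans j< (≤-reflexive (+-identityʳ i))) (≤⇒≯ i≤j)
  at∈range {j} i (suc l) i≤j j< with m≤n⇒m<n∨m≡n i≤j
  ... | inj₂ refl = here refl
  ... | inj₁ i<j = there (at∈range (suc i) l i<j (≤-trans j< (≤-reflexive (+-suc i l))))

  length-range : ∀ i l → length (range i l) ≡ l
  length-range i zero    = refl
  length-range i (suc l) = cong suc (length-range (suc i) l)

  cycle-vertices : List V
  cycle-vertices = tabulate (cyc C)

  cycle-unique : Unique cycle-vertices
  cycle-unique = tabulate⁺ (Cycle.inj C)

  range-vertices : ∀ i → range i (suc k) ↭ cycle-vertices
  range-vertices i = ↭-trans (range-rotate i) (↭-sym (unique-⊆⇒↭ cycle-unique sub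
    (≤-reflexive (trans (length-range 0 (suc k)) (sym (length-tabulate (cyc C)))))))
    where
    sub : ∀ {v} → v ∈ cycle-vertices → v ∈ range 0 (suc k)
    sub v∈ with ∈-tabulate⁻ {f = cyc C} v∈
    ... | j , refl = subst (λ j′ → cyc C j′ ∈ range 0 (suc k)) (toℕ-mod-id j) (at∈range 0 (suc k) z≤n (toℕ<n j))

  at-toℕ : ∀ i → at (toℕ i) ≡ cyc C i
  at-toℕ i = cong (cyc C) (toℕ-mod-id i)

  module _ (order : n ≡ suc (suc k)) {x} (off : ¬ OnCycle C x) where

    spanning : x ∷ cycle-vertices ↭ allFin n
    spanning = unique-spans (All.tabulate (λ { v∈ refl → off (on v∈) }) ∷ cycle-unique)
      (trans (cong suc (length-tabulate (cyc C))) (sym order))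
      where
      on : x ∈ cycle-vertices → OnCycle C x
      on x∈ with ∈-tabulate⁻ {f = cyc C} x∈
      ... | j , eq = j , sym eq

    off-unique : ∀ {x′} → ¬ OnCycle C x′ → x′ ≡ x
    off-unique {x′} off′ with ∈-resp-↭ (↭-sym spanning) (∈-allFin x′)
    ... | here eq = eq
    ... | there x′∈ with ∈-tabulate⁻ {f = cyc C} x′∈
    ...   | j , eq = contradiction (j , sym eq) off′

    cycle-circuit : ∀ i → Circuit x (cyc C i) (range (suc (toℕ i)) k)
    cycle-circuit i = subst (λ y → Circuit x y (range (suc (toℕ i)) k)) (at-toℕ i) (circuit
      (subst (Walk _ _) (at-period (toℕ i)) (range-walk (toℕ i) k))
      (↭-trans (↭-prep x (range-vertices (toℕ i))) spanning))

last-arc : ∀ {n} (D : Digraph n) {u} xs {w v} → Walks.Walk D u (xs ++ [ w ]) v → Arc D w v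
last-arc D xs p with Walks.walk-split D xs p
... | _ , Walks.step r = r

neighbours : ∀ {n k} (D : Digraph n) (C : Cycle D (suc k)) {x y} i →
  Walks.Walk D x (FromCycle.range D C (suc (toℕ i)) k) y →
  1 ≤ k → Arc D (cyc C (cprev i)) y × Arc D x (cyc C (cnext i))
neighbours {k = suc k} D C {x} {y} i p@(r Walks.∷ _) _ =
  -- The last vertex of the range has position `suc (toℕ i) + k`; after `+-suc` this is how `cprev`
  -- writes i - 1 modulo the length.
  subst (λ j → Arc D (at j) y) (sym (+-suc (toℕ i) k))
    (last-arc D (range (suc (toℕ i)) k) (subst (λ xs → Walks.Walk D x xs y) (range-snoc (suc (toℕ i)) k) p)) , r
  where open FromCycle D C

tabulate-lookup : ∀ {A : Set} (xs : List A) → tabulate (Vec.lookup (Vec.fromList xs)) ≡ xs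
tabulate-lookup []       = refl
tabulate-lookup (x ∷ xs) = cong (x ∷_) (tabulate-lookup xs)

unique-tabulate : ∀ {A : Set} {k} (f : Fin k → A) → Unique (tabulate f) → ∀ i j → f i ≡ f j → i ≡ j
unique-tabulate f (_ ∷ _)  zero    zero    eq = refl
unique-tabulate f (x∉ ∷ _) zero    (suc j) eq = contradiction eq (All.lookup x∉ (∈-tabulate⁺ {f = f ∘ suc} j))
unique-tabulate f (x∉ ∷ _) (suc i) zero    eq = contradiction (sym eq) (All.lookup x∉ (∈-tabulate⁺ {f = f ∘ suc} i))
unique-tabulate f (_ ∷ q)  (suc i) (suc j) eq = cong suc (unique-tabulate (f ∘ suc) q i j eq)

countB-tabulate : ∀ {A : Set} {k} p (f : Fin k → A) → countB (λ i → p (f i)) (allFin k) ≡ countB p (tabulate f)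
countB-tabulate p f = cong sum (trans (map-tabulate (λ i → i) _) (sym (map-tabulate f _)))

-- From closed paths to cycles

module FromPiece {n} (D : Digraph n) where

  open Segments D

  -- Cycles are presented by vectors because these can be searched exhaustively.
  IsCycle : ∀ {k} → Vec V k → Set
  IsCycle v = (∀ i j → Vec.lookup v i ≡ Vec.lookup v j → i ≡ j) × (∀ i → Arc D (Vec.lookup v i) (Vec.lookup v (cnext i)))

  IsCycle? : ∀ {k} (v : Vec V k) → Dec (IsCycle v)
  IsCycle? v = all? (λ i → all? λ j → (Vec.lookup v i ≟ Vec.lookup v j) →-dec (i ≟ j)) ×-dec
               all? (λ i → Arc? (Vec.lookup v i) (Vec.lookup v (cnext i)))

  as-cycle : ∀ {k} → 2 ≤ k → (v : Vec V k) → IsCycle v → Cycle D k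
  as-cycle 2≤k v (injective , arcs) = record
    { cyc = Vec.lookup v ; inj = λ {i} {j} → injective i j ; len≥2 = 2≤k ; steps = arcs }

  seg-first : ∀ {a b} {xs : List V} → Seg a xs b → ∀ (i : Fin (length xs)) → toℕ i ≡ 0 → Vec.lookup (Vec.fromList xs) i ≡ a
  seg-first one        zero _ = refl
  seg-first (cons _ _) zero _ = refl

  seg-last : ∀ {a b} {xs : List V} → Seg a xs b → ∀ (i : Fin (length xs)) → suc (toℕ i) ≡ length xs → Vec.lookup (Vec.fromList xs) i ≡ b
  seg-last one        zero    _  = refl
  seg-last (cons _ one) zero    ()
  seg-last (cons _ (cons _ _)) zero    ()
  seg-last (cons _ s) (suc i) eq = seg-last s i (suc-injective eq)

  seg-step : ∀ {a b} {xs : List V} → Seg a xs b → ∀ (i j : Fin (length xs)) → toℕ j ≡ suc (toℕ i) →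
             Arc D (Vec.lookup (Vec.fromList xs) i) (Vec.lookup (Vec.fromList xs) j)
  seg-step one        zero    zero    ()
  seg-step (cons r s) zero    (suc j) eq = subst (Arc D _) (sym (seg-first s j (suc-injective eq))) r
  seg-step (cons _ s) (suc i) (suc j) eq = seg-step s i j (suc-injective eq)

  closed-cycle : ∀ X → X ⟶ X → Unique (verts X) → IsCycle (Vec.fromList (verts X))
  closed-cycle (piece {a} {b} {xs} s) r q =
    unique-tabulate _ (subst Unique (sym (tabulate-lookup xs)) q) , closing xs s
    where
    closing : ∀ xs → Seg a xs b → ∀ i → Arc D (Vec.lookup (Vec.fromList xs) i) (Vec.lookup (Vec.fromList xs) (cnext i))
    closing (x ∷ xs) s i with m≤n⇒m<n∨m≡n (toℕ<n i)
    ... | inj₁ i< = seg-step s i (cnext i) (trans (toℕ-mod (suc (toℕ i))) (m<n⇒m%n≡m i<))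
    ... | inj₂ i≡ = subst₂ (Arc D) (sym (seg-last s i i≡))
      (sym (seg-first s (cnext i) (trans (toℕ-mod (suc (toℕ i))) (trans (cong (_% suc (length xs)) i≡) (n%n≡0 (suc (length xs))))))) r

  ∃cycle : ∀ {k} X → X ⟶ X → Unique (verts X) → length (verts X) ≡ k →
           ∃ λ (v : Vec V k) → IsCycle v × tabulate (Vec.lookup v) ≡ verts X
  ∃cycle X r q refl = Vec.fromList (verts X) , closed-cycle X r q , tabulate-lookup (verts X)

-- The case distinction

module Main (m : ℕ) (D : Digraph (2 * suc m + 1)) where

  open Segments D
  open Walks D
  open FromPiece D

  private
    M = suc m
    n = 2 * M + 1

  order : n ≡ suc (2 * M)
  order = +-comm (2 * M) 1

  Fine : V → ℕ → Set
  Fine x c = M ≤ indeg D x × M ≤ outdeg D x × 3 ≤ c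

  Fine? : ∀ x c → Dec (Fine x c)
  Fine? x c = (M ≤? indeg D x) ×-dec ((M ≤? outdeg D x) ×-dec (3 ≤? c))

  -- As (i) or (iv) holds for a bad cycle, only the remaining case needs the structural argument.
  Bad : Vec V (2 * M) → Set
  Bad v = IsCycle v × ∃ λ x → (∀ i → Vec.lookup v i ≢ x) ×
          ¬ Fine x (countB (λ i → nonAdjB D x (Vec.lookup v i)) (allFin (2 * M)))

  Bad? : ∀ v → Dec (Bad v)
  Bad? v = IsCycle? v ×-dec Fin.any? λ x → all? (λ i → ¬? (Vec.lookup v i ≟ x)) ×-dec ¬? (Fine? x _)

  Dominating : Set
  Dominating = Σ ℕ λ k → Σ (Cycle D k) λ C → ∀ v → M ≤ outdeg D v → M ≤ indeg D v → OnCycle C v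

  hamiltonian : ∃ (IsCycle {n}) → Dominating
  hamiltonian (v , c) = n , C , λ u _ _ → on u
    where
    C : Cycle D n
    C = as-cycle (s≤s (subst (1 ≤_) (sym (+-comm _ 1)) (s≤s z≤n))) v c
    on : ∀ u → OnCycle C u
    on u with ∈-tabulate⁻ {f = cyc C} (∈-resp-↭ (↭-sym (unique-spans (tabulate⁺ (Cycle.inj C)) (length-tabulate (cyc C)))) (∈-allFin u))
    ... | i , eq = i , sym eq

  length-2M : 2 ≤ 2 * M
  length-2M = s≤s (≤-trans (s≤s z≤n) (m≤n+m (M + 0) m))

  module _ (v : Vec V (2 * M)) {x} (c : IsCycle v) (avoids : ∀ i → Vec.lookup v i ≢ x) where

    private
      C : Cycle D (2 * M)
      C = as-cycle length-2M v c

    off-C : ∀ {u} → ¬ OnCycle C u → u ≡ x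
    off-C = FromCycle.off-unique D C order λ (i , eq) → avoids i eq

    -- x is the only vertex off the cycle, so (i) only needs x to have a small semidegree.
    dominating : (∀ u → M ≤ outdeg D u → M ≤ indeg D u → u ≢ x) → Dominating
    dominating h = 2 * M , C , λ u out≥ in≥ →
      decidable-stable (Fin.any? λ i → cyc C i ≟ u) (h u out≥ in≥ ∘ off-C)

    few-nonneighbours : ¬ 3 ≤ nonAdjCount C x → PropIV D C
    few-nonneighbours few x′ off 3≤ = contradiction (subst (λ z → 3 ≤ nonAdjCount C z) (off-C off) 3≤) few

  exceptional : ∃ Bad → Dominating ⊎ (Σ (Cycle D (2 * M)) λ C → PropIV D C)
  exceptional (v , c , x , avoids , ¬fine) with M ≤? indeg D x | M ≤? outdeg D x
  ... | no ¬in  | _       = inj₁ (dominating v c avoids λ { u _ in≥ refl → ¬in in≥ })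
  ... | yes _   | no ¬out = inj₁ (dominating v c avoids λ { u out≥ _ refl → ¬out out≥ })
  ... | yes in≥ | yes out≥ = inj₂ (as-cycle length-2M v c ,
        few-nonneighbours v c avoids λ 3≤ → ¬fine (in≥ , out≥ , 3≤))

  module Regular (¬ham : ¬ ∃ (IsCycle {n})) (¬bad : ¬ ∃ Bad) where

    no-ham : ∀ X → X ⟶ X → ¬ (verts X ↭ allFin n)
    no-ham X r σ = case ∃cycle X r (Unique-resp-↭ (↭-sym σ) (allFin⁺ n)) (trans (↭-length σ) (length-tabulate (λ i → i))) of
      λ (v , c , _) → ¬ham (v , c)

    -- A closed path violating this would, read as a vector, be a bad cycle.
    good : ∀ {x} X → X ⟶ X → x ∷ verts X ↭ allFin n → Fine x (countB (nonAdjB D x) (verts X))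
    good {x} X r σ with Unique-resp-↭ (↭-sym σ) (allFin⁺ n)
    ... | x∉ ∷ q with ∃cycle X r q (suc-injective (trans (Degrees.suc-length D x σ) order))
    ...   | v , c , eq = decidable-stable (Fine? x _) λ ¬fine → ¬bad (v , c , x ,
      (λ i eq′ → All.lookup x∉ (subst (_∈ verts X) eq′ (subst (Vec.lookup v i ∈_) eq (∈-tabulate⁺ {f = Vec.lookup v} i))) refl) ,
      ¬fine ∘ subst (Fine x) (trans (countB-tabulate (nonAdjB D x) (Vec.lookup v)) (cong (countB (nonAdjB D x)) eq)))

    open Good {M} D no-ham good
    open Rules rigid

    property : ∀ C → PropIV {k = 2 * M} D C
    property C x off _ i ¬adj = proj₁ ends , proj₂ ends , twin-property c xi
      where
      c = FromCycle.cycle-circuit D C order off i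
      xi : NonAdj x (cyc C i)
      xi = nonAdjB⇒NonAdj D x (cyc C i) (cong not (Bool.¬-not ¬adj))
      -- x stands in the place of `cyc C i`, so its neighbours on the new circuit are the cyclic
      -- neighbours of position i.
      ends = neighbours D C i (Circuit.walk (exchange c xi)) (≤-pred length-2M)

theorem2 : (m : ℕ) → 1 ≤ m → (D : Digraph (2 * m + 1)) → Strong D →
    Cycle D (2 * m) →
    (Σ ℕ λ k → Σ (Cycle D k) λ C →
    ∀ (v : Fin (2 * m + 1)) → m ≤ outdeg D v → m ≤ indeg D v → OnCycle C v)
    ⊎ ((Iso D D5 ⊎ Iso D D7) ⊎ (IsoToL1 D ⊎ IsoToL2 m D))
    ⊎ (ContainsSpanning D (Kbip m *) × IsoToSpanningSub D (Kjoin m *))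
    ⊎ (Σ (Cycle D (2 * m)) λ C → PropIV D C)
theorem2 (suc m) _ D _ C with ∃Vec? _ (FromPiece.IsCycle? D) | ∃Vec? _ (Main.Bad? m D)
... | yes ham | _       = inj₁ (Main.hamiltonian m D ham)
... | no _    | yes bad = Sum.map₂ (inj₂ ∘ inj₂) (Main.exceptional m D bad)
-- When both searches fail, (iv) holds for every cycle of length 2m, in particular for the given
-- one.
... | no ¬ham | no ¬bad = inj₂ (inj₂ (inj₂ (C , Main.Regular.property m D ¬ham ¬bad C)))
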